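{- Let $k\geqslant1$, let $m(k)=\lceil k^2/2+2k+1\rceil$, and for $i=1,\dots,m(k)$ define $\sigma_k(i)=i(k+2)\bmod (m(k)+1)$ if $k$ is odd and $\sigma_k(i)=i(k+1)\bmod (m(k)+1)$ if $k$ is even (residues taken in $\{0,\dots,m(k)\}$). Then $\sigma_k$, which is a permutation of $[m(k)]$, is $k$-prolific.
   Context: $S_n$ is the set of permutations of $[n]$, in one-line notation. A permutation $\sigma\in S_n$ contains $\pi\in S_r$ ($\pi\preceq\sigma$) if there are indices $i_1<\dots<i_r$ with $\sigma(i_1)\cdots\sigma(i_r)$ in the same relative order as $\pi$; for $n>k\geqslant1$, $\sigma$ is $k$-prolific if $|\{\pi\in S_{n-k}:\pi\preceq\sigma\}|=\binom{n}{k}$. -}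

module Defs where

open import Data.Nat using (ℕ; zero; suc; _+_; _*_; _<_; _≤_; _≡ᵇ_)
open import Data.Nat.DivMod using (_/_; _%_)
open import Data.Nat.Combinatorics using (_C_)
open import Data.Bool using (if_then_else_)
open import Data.Fin using (Fin; cast)
open import Data.List using (List; map; upTo; length; lookup)
open import Data.List.Membership.Propositional using (_∈_)
open import Data.List.Relation.Unary.Unique.Propositional using (Unique)
open import Data.List.Relation.Binary.Permutation.Propositional using (_↭_)
open import Data.List.Relation.Binary.Sublist.Propositional using (_⊆_)
open import Data.Product using (Σ; ∃; _×_)
open import Function.Bundles using (_⇔_)
open import Relation.Binary.PropositionalEquality using (_≡_)

range1 : ℕ → List ℕ
range1 n = map suc (upTo n)

-- π ∈ S_n in one-line notation: a list which is a rearrangement of 1,…,n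
IsPerm : ℕ → List ℕ → Set
IsPerm n π = π ↭ range1 n

SameOrder : List ℕ → List ℕ → Set
SameOrder xs ys =
  Σ (length xs ≡ length ys) λ eq →
    ∀ (i j : Fin (length xs)) →
      (lookup xs i < lookup xs j) ⇔ (lookup ys (cast eq i) < lookup ys (cast eq j))

_≼_ : List ℕ → List ℕ → Set
π ≼ σ = ∃ λ s → (s ⊆ σ) × SameOrder s π

-- |{π ∈ S_r : π ≼ σ}| = c, expressed by an explicit duplicate-free list
-- enumerating exactly that set
PatternCount : ℕ → List ℕ → ℕ → Set
PatternCount r σ c =
  ∃ λ (L : List (List ℕ)) →
    Unique L × length L ≡ c ×
    (∀ π → π ∈ L ⇔ (IsPerm r π × π ≼ σ))

KProlific : ℕ → List ℕ → Set
KProlific k σ =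
  (1 ≤ k) × (k < length σ) ×
  Σ ℕ λ r → (r + k ≡ length σ) × PatternCount r σ (length σ C k)

-- m(k) = ⌈k²/2 + 2k + 1⌉ = ⌊(k²+1)/2⌋ + 2k + 1
m : ℕ → ℕ
m k = (k * k + 1) / 2 + 2 * k + 1

isOdd : ℕ → _
isOdd k = k % 2 ≡ᵇ 1

mult : ℕ → ℕ
mult k = if isOdd k then k + 2 else k + 1

σ : ℕ → List ℕ
σ k = map (λ i → (i * mult k) % suc (m k)) (range1 (m k))

{-# OPTIONS --safe #-}

-- Two occurrences a, b of the same pattern of length n − k in a permutation whose points are pairwise at
-- ℓ¹-distance at least k + 2 coincide. Write D and E for the k points missed by a and by b. The
-- displacement from a i to b i in either coordinate is the number of points of E below b i minus the number
-- of points of D below a i, hence at most k, so a point strictly inside the box spanned by a i and b i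
-- would have to be closer than k + 2 to one of them. Up to reflecting the picture and exchanging a and b, a
-- point that moves at all moves up and to the right. Among the points moving so, choose p ↦ q and p′ ↦ q′
-- (possibly equal) such that p is the leftmost one below q′ and p′ is the lowest one to the left of q. The
-- rectangle R with left side at p, right side at q, bottom at p′ and top at q′ contains no points other
-- than p and p′. A region closed under a i ↦ b i contains at least as many points of D as of E; applied to
-- a suitable region this bounds the width plus the height of R by k + |R|, which contradicts d(p, q) ≥ k +
-- 2 if p = p′ and d(p, p′) ≥ k + 2 otherwise. Deleting different k-sets thus gives different patterns, and
-- it remains to see that σ k has breadth k + 2. With K = k + 2, modulus M and multiplier t, this is
-- elementary from 2 M = K² + 1 and t = K for odd k, and 2 M = K² and t = K − 1 for even k.
module Submission where

open import Defs
open import Data.Bool using (if_then_else_)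
open import Data.Empty using (⊥; ⊥-elim)
open import Data.Fin using (Fin; zero; suc; toℕ; cast) renaming (_≟_ to _≟ᶠ_)
open import Data.Fin.Properties using (any?; toℕ-injective; toℕ<n; toℕ-cast; cast-is-id; cast-trans; cast-involutive)
open import Data.List using (List; []; _∷_; _++_; map; length; lookup; upTo; applyUpTo)
open import Data.List.Membership.Propositional using (_∈_)
open import Data.List.Membership.Propositional.Properties using (∈-map⁺; ∈-map⁻; ∈-++⁺ˡ; ∈-++⁺ʳ; ∈-++⁻; ∈-upTo⁺; ∈-upTo⁻; ∈-lookup; ∈-∃++)
open import Data.List.Properties using (length-map; length-++; length-upTo; lookup-applyUpTo; map-upTo; map-∘; map-id; map-id-local; ∷-injectiveʳ)
open import Data.List.Relation.Binary.Permutation.Propositional using (_↭_; refl; prep; swap; ↭-sym; ↭⇒↭ₛ) renaming (trans to ↭-step)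
open import Data.List.Relation.Binary.Permutation.Propositional.Properties using (∈-resp-↭; ↭-length; shift)
open import Data.List.Relation.Binary.Permutation.Setoid.Properties using (Unique-resp-↭)
open import Data.List.Relation.Binary.Sublist.Propositional using (_⊆_; []; _∷_; _∷ʳ_; minimum) renaming (lookup to ⊆-lookup)
open import Data.List.Relation.Unary.All as All using ([]; _∷_)
import Data.List.Relation.Unary.All.Properties as Allₚ
open import Data.List.Relation.Unary.AllPairs using ([]; _∷_)
open import Data.List.Relation.Unary.Any using (here; there; index)
open import Data.List.Relation.Unary.Any.Properties using (lookup-index)
open import Data.List.Relation.Unary.Unique.Propositional using (Unique)
import Data.List.Relation.Unary.Unique.Propositional.Properties as Uniqueₚ
open import Data.Nat
open import Data.Nat.Combinatorics using (_C_; nCk≡nC[n∸k]; nCn≡1; nCk+nC[k+1]≡[n+1]C[k+1])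
open import Data.Nat.DivMod using (m≡m%n+[m/n]*n; m%n<n; m*n/n≡m; /-monoˡ-≤; [m+kn]%n≡m%n; +-distrib-/-∣ʳ)
open import Data.Nat.Divisibility using (_∣_; ∣⇒≤; ∣m+n∣m⇒∣n; ∣m⇒∣m*n; m∣m*n; n∣m*n)
open import Data.Nat.Properties
open import Data.Nat.Tactic.RingSolver using (solve-∀)
open import Data.Product using (Σ; ∃; _×_; _,_; proj₁; proj₂)
open import Data.Sum using (_⊎_; inj₁; inj₂)
open import Data.Unit using (tt)
open import Function using (_∘_)
open import Function.Bundles using (_⇔_; mk⇔; Equivalence)
open import Relation.Binary.Definitions using (tri<; tri≈; tri>)
open import Relation.Binary.PropositionalEquality
open import Relation.Nullary using (¬_; Dec; yes; no; does; contradiction)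
open import Relation.Nullary.Decidable using (_×-dec_; _⊎-dec_; ¬?)
open import Algebra.Properties.CommutativeMonoid.Sum +-0-commutativeMonoid using (sum; sum-cong-≗; ∑-distrib-+; ∑-comm; sum-replicate-zero)
open import Algebra.Properties.Semiring.Sum +-*-semiring using (*-distribˡ-sum)

-- Indicators and finite sums.

⟦_⟧ : ∀ {ℓ} {P : Set ℓ} → Dec P → ℕ
⟦ P? ⟧ = if does P? then 1 else 0

⟦⟧-mono : ∀ {ℓ ℓ′} {P : Set ℓ} {Q : Set ℓ′} (P? : Dec P) (Q? : Dec Q) → (P → Q) → ⟦ P? ⟧ ≤ ⟦ Q? ⟧
⟦⟧-mono (no _)  _        f = z≤n
⟦⟧-mono (yes p) (yes _)  f = ≤-refl
⟦⟧-mono (yes p) (no ¬q)  f = contradiction (f p) ¬q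

⟦⟧-cong : ∀ {ℓ ℓ′} {P : Set ℓ} {Q : Set ℓ′} (P? : Dec P) (Q? : Dec Q) → (P → Q) → (Q → P) → ⟦ P? ⟧ ≡ ⟦ Q? ⟧
⟦⟧-cong P? Q? f g = ≤-antisym (⟦⟧-mono P? Q? f) (⟦⟧-mono Q? P? g)

⟦⟧-yes : ∀ {ℓ} {P : Set ℓ} (P? : Dec P) → P → ⟦ P? ⟧ ≡ 1
⟦⟧-yes (yes _) p = refl
⟦⟧-yes (no ¬p) p = contradiction p ¬p

⟦⟧-no : ∀ {ℓ} {P : Set ℓ} (P? : Dec P) → ¬ P → ⟦ P? ⟧ ≡ 0
⟦⟧-no (yes p) ¬p = contradiction p ¬p
⟦⟧-no (no _)  _  = refl

⟦⟧≤1 : ∀ {ℓ} {P : Set ℓ} (P? : Dec P) → ⟦ P? ⟧ ≤ 1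
⟦⟧≤1 P? = ⟦⟧-mono P? (yes tt) _

⟦⟧-⊎ : ∀ {ℓ ℓ′ ℓ″} {P : Set ℓ} {Q : Set ℓ′} {R : Set ℓ″} (P? : Dec P) (Q? : Dec Q) (R? : Dec R) →
       (P → Q ⊎ R) → ⟦ P? ⟧ ≤ ⟦ Q? ⟧ + ⟦ R? ⟧
⟦⟧-⊎ (no _)  _  _ f = z≤n
⟦⟧-⊎ (yes p) Q? R? f with f p
... | inj₁ q rewrite ⟦⟧-yes Q? q = s≤s z≤n
... | inj₂ r rewrite ⟦⟧-yes R? r = m≤n+m 1 _

sum-mono : ∀ {n} (f g : Fin n → ℕ) → (∀ i → f i ≤ g i) → sum f ≤ sum g
sum-mono {zero}  f g f≤g = z≤n
sum-mono {suc n} f g f≤g = +-mono-≤ (f≤g zero) (sum-mono (f ∘ suc) (g ∘ suc) (f≤g ∘ suc))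

sum-1 : ∀ n → sum {n} (λ _ → 1) ≡ n
sum-1 zero    = refl
sum-1 (suc n) = cong suc (sum-1 n)

sum-δ : ∀ {n} (p : Fin n) (f : Fin n → ℕ) → sum (λ w → f w * ⟦ p ≟ᶠ w ⟧) ≡ f p
sum-δ {suc n} zero f = trans (cong₂ _+_ (*-identityʳ (f zero)) eq) (+-identityʳ (f zero))
  where
  eq : sum (λ w → f (suc w) * 0) ≡ 0
  eq = trans (sum-cong-≗ (λ w → *-zeroʳ (f (suc w)))) (sum-replicate-zero n)
sum-δ {suc n} (suc p) f = cong₂ _+_ (*-zeroʳ (f zero)) (sum-δ p (f ∘ suc))

sum-δ₁ : ∀ {n} (p : Fin n) → sum (λ w → ⟦ p ≟ᶠ w ⟧) ≡ 1
sum-δ₁ p = trans (sum-cong-≗ (λ w → sym (*-identityˡ ⟦ p ≟ᶠ w ⟧))) (sum-δ p (λ _ → 1))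

argmin : ∀ {r} {P : Fin r → Set} → (∀ i → Dec (P i)) → (f : Fin r → ℕ) → ∃ P →
         Σ (Fin r) λ i → P i × (∀ j → P j → f i ≤ f j)
argmin {r} {P} P? f (i , Pi) = go (f i) i Pi ≤-refl
  where
  -- `c` bounds the current value from above and drops with every improvement, so it serves as the
  -- measure of the recursion.
  go : ∀ c i → P i → f i ≤ c → Σ (Fin r) λ i → P i × (∀ j → P j → f i ≤ f j)
  go c i Pi fi≤c with any? (λ j → P? j ×-dec (f j <? f i))
  ... | no ¬lower = i , Pi , λ j Pj → ≮⇒≥ (λ lt → ¬lower (j , Pj , lt))
  go zero    i Pi fi≤c | yes (j , Pj , fj<fi) = contradiction (<-≤-trans fj<fi fi≤c) n≮0
  go (suc c) i Pi fi≤c | yes (j , Pj , fj<fi) = go c j Pj (≤-pred (≤-trans fj<fi fi≤c))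

-- Points missed by an injection.

Injective : ∀ {r n} → (Fin r → Fin n) → Set
Injective c = ∀ {i j} → c i ≡ c j → i ≡ j

module _ {r n} (c : Fin r → Fin n) where

  fibre : Fin n → ℕ
  fibre w = sum (λ i → ⟦ c i ≟ᶠ w ⟧)

  -- fibre w ≤ 1 if c is injective, so that 1 ∸ fibre w then indicates the points missed by c.
  missed : (Fin n → ℕ) → ℕ
  missed f = sum (λ w → f w * (1 ∸ fibre w))

  missed-mono : ∀ f g → (∀ w → f w ≤ g w) → missed f ≤ missed g
  missed-mono f g f≤g = sum-mono _ _ (λ w → *-monoˡ-≤ (1 ∸ fibre w) (f≤g w))

  missed-+ : ∀ f g → missed (λ w → f w + g w) ≡ missed f + missed g
  missed-+ f g = trans (sum-cong-≗ (λ w → *-distribʳ-+ (1 ∸ fibre w) (f w) (g w))) (∑-distrib-+ {n} _ _)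

  missed≤sum : ∀ f → missed f ≤ sum f
  missed≤sum f = sum-mono _ _ λ w →
    ≤-trans (*-monoʳ-≤ (f w) (m∸n≤m 1 (fibre w))) (≤-reflexive (*-identityʳ (f w)))

  module _ (c-inj : Injective c) where

    fibre≤1 : ∀ w → fibre w ≤ 1
    fibre≤1 w with any? (λ i → c i ≟ᶠ w)
    ... | yes (i , refl) = ≤-trans (sum-mono _ _ (λ j → ⟦⟧-mono (c j ≟ᶠ w) (i ≟ᶠ j) (c-inj ∘ sym)))
                                   (≤-reflexive (sum-δ₁ i))
    ... | no ∄i = ≤-trans (sum-mono _ (λ _ → 0) (λ j → ≤-reflexive (⟦⟧-no (c j ≟ᶠ w) (λ e → ∄i (j , e)))))
                          (≤-trans (≤-reflexive (sum-replicate-zero r)) z≤n)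

    -- Exchanging the order of summation turns the sum over the image into one weighted by `fibre`;
    -- the weights `fibre w` and `1 ∸ fibre w` add up to 1.
    sum-split : ∀ f → sum (f ∘ c) + missed f ≡ sum f
    sum-split f = begin
      sum (f ∘ c) + missed f
        ≡⟨ cong (_+ missed f) (sum-cong-≗ (λ i → sym (sum-δ (c i) f))) ⟩
      sum (λ i → sum (λ w → f w * ⟦ c i ≟ᶠ w ⟧)) + missed f
        ≡⟨ cong (_+ missed f) (∑-comm {r} {n} _) ⟩
      sum (λ w → sum (λ i → f w * ⟦ c i ≟ᶠ w ⟧)) + missed f
        ≡⟨ cong (_+ missed f) (sum-cong-≗ (λ w → sym (*-distribˡ-sum (f w) (λ i → ⟦ c i ≟ᶠ w ⟧)))) ⟩
      sum (λ w → f w * fibre w) + missed f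
        ≡⟨ sym (∑-distrib-+ {n} _ _) ⟩
      sum (λ w → f w * fibre w + f w * (1 ∸ fibre w))
        ≡⟨ sum-cong-≗ (λ w → trans (sym (*-distribˡ-+ (f w) (fibre w) _))
                              (trans (cong (f w *_) (m+[n∸m]≡n (fibre≤1 w))) (*-identityʳ (f w)))) ⟩
      sum f ∎
      where open ≡-Reasoning

    missed-1 : ∀ {k} → r + k ≡ n → missed (λ _ → 1) ≡ k
    missed-1 {k} r+k≡n = +-cancelˡ-≡ r _ _ (begin
      r + missed (λ _ → 1)                ≡⟨ cong (_+ missed (λ _ → 1)) (sym (sum-1 r)) ⟩
      sum {r} (λ _ → 1) + missed (λ _ → 1)    ≡⟨ sum-split (λ _ → 1) ⟩
      sum {n} (λ _ → 1)                   ≡⟨ sum-1 n ⟩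
      n                                   ≡⟨ sym r+k≡n ⟩
      r + k                               ∎)
      where open ≡-Reasoning

-- Coordinates and pairs of embeddings with the same pattern.

below : ∀ {n} → (Fin n → ℕ) → ℕ → Fin n → ℕ
below x c w = ⟦ x w <? c ⟧

-- The field `rank` makes value minus rank constant, so the values are consecutive. Where they start
-- is left open: positions start at 0, entries at 1, and reflection has to preserve the notion.
record Coordinate {n} (x : Fin n → ℕ) : Set where
  field
    injective : ∀ {u v} → x u ≡ x v → u ≡ v
    top       : ℕ
    x≤top     : ∀ u → x u ≤ top
    rank      : ∀ u v → x v + sum (below x (x u)) ≡ x u + sum (below x (x v))

record OrderIso {r n} (a b : Fin r → Fin n) (x : Fin n → ℕ) : Set where
  field
    to   : ∀ i j → x (a i) < x (a j) → x (b i) < x (b j)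
    from : ∀ i j → x (b i) < x (b j) → x (a i) < x (a j)

open OrderIso

record Embeddings {n r} (k : ℕ) (a b : Fin r → Fin n) (x y : Fin n → ℕ) : Set where
  field
    r+k≡n   : r + k ≡ n
    a-inj   : Injective a
    b-inj   : Injective b
    x-coord : Coordinate x
    y-coord : Coordinate y
    x-iso   : OrderIso a b x
    y-iso   : OrderIso a b y
    breadth : ∀ {u v} → u ≢ v → k + 2 ≤ ∣ x u - x v ∣ + ∣ y u - y v ∣

module _ {n r} {a b : Fin r → Fin n} {x : Fin n → ℕ} (iso : OrderIso a b x) where

  iso-≤ : ∀ i j → x (a i) ≤ x (a j) → x (b i) ≤ x (b j)
  iso-≤ i j le = ≮⇒≥ (λ lt → <⇒≱ (from iso j i lt) le)

  -- Since the embeddings order their points alike, as many image points of `a` lie below `a i` as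
  -- image points of `b` below `b i`. Cancelling these in `rank` leaves only missed points.
  displacement : Coordinate x → Injective a → Injective b → ∀ i →
          x (b i) + missed a (below x (x (a i))) ≡ x (a i) + missed b (below x (x (b i)))
  displacement coord a-inj b-inj i = +-cancelˡ-≡ s _ _ (begin
    s + (x (b i) + D)             ≡⟨ swap₁ s (x (b i)) D ⟩
    x (b i) + (s + D)             ≡⟨ cong (x (b i) +_) (sum-split a a-inj _) ⟩
    x (b i) + sum (below x (x (a i))) ≡⟨ Coordinate.rank coord (a i) (b i) ⟩
    x (a i) + sum (below x (x (b i))) ≡⟨ cong (x (a i) +_) (sym (sum-split b b-inj _)) ⟩
    x (a i) + (s′ + E)            ≡⟨ cong (λ z → x (a i) + (z + E)) (sym s≡s′) ⟩
    x (a i) + (s + E)             ≡⟨ swap₁ (x (a i)) s E ⟩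
    s + (x (a i) + E)             ∎)
    where
    open ≡-Reasoning
    s = sum (below x (x (a i)) ∘ a)
    s′ = sum (below x (x (b i)) ∘ b)
    D = missed a (below x (x (a i)))
    E = missed b (below x (x (b i)))
    s≡s′ : s ≡ s′
    s≡s′ = sum-cong-≗ (λ j → ⟦⟧-cong (x (a j) <? x (a i)) (x (b j) <? x (b i)) (to iso j i) (from iso j i))
    swap₁ : ∀ l m o → l + (m + o) ≡ m + (l + o)
    swap₁ = solve-∀

-- Regions closed under passing from `a j` to `b j`.

module _ {n r} (a b : Fin r → Fin n) where

  Mover : (Fin n → ℕ) → Fin n → Set
  Mover x w = ∃ λ i → a i ≡ w × x w < x (b i)

  mover? : ∀ x w → Dec (Mover x w)
  mover? x w = any? (λ i → (a i ≟ᶠ w) ×-dec (x w <? x (b i)))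

  -- Half x y i i′ ∪ Half y x i′ i contains every point that is left of q = b i, below q′ = b i′, and either left
  -- of p = a i or below p′ = a i′; the condition on movers makes it closed under a j ↦ b j (half-step).
  Half : (x y : Fin n → ℕ) → Fin r → Fin r → Fin n → Set
  Half x y i i′ w = x w < x (a i) × (y w < y (b i′) ⊎ ¬ Mover x w)

  half? : ∀ x y i i′ w → Dec (Half x y i i′ w)
  half? x y i i′ w = (x w <? x (a i)) ×-dec ((y w <? y (b i′)) ⊎-dec ¬? (mover? x w))

  -- A point that does not move right stays left of `a i`, and its image is no mover: if `b j` is
  -- `a l`, then `a l` is not right of `a j`, so `b l` is not right of `b j`. A point that moves
  -- right cannot also move up, by the choice of `a i`; it stays below `b i′` and at worst passes
  -- into the other half.
  half-step : ∀ {x y} → OrderIso a b x → OrderIso a b y → ∀ i i′ →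
              (∀ j → x (a j) < x (b j) → y (a j) < y (b j) → y (a j) < y (b i′) → x (a i) ≤ x (a j)) →
              ∀ j → Half x y i i′ (a j) → Half x y i i′ (b j) ⊎ Half y x i′ i (b j)
  half-step {x} {y} x-iso y-iso i i′ leftmost j (xaj<xai , low) with x (a j) <? x (b j)
  ... | no ¬right = inj₁ (≤-<-trans (≮⇒≥ ¬right) xaj<xai , inj₂ λ where
          (l , al≡bj , xbj<xbl) → <⇒≱ xbj<xbl
             (iso-≤ x-iso l j (subst (λ z → x z ≤ x (a j)) (sym al≡bj) (≮⇒≥ ¬right))))
  ... | yes right = helper low
    where
    helper : y (a j) < y (b i′) ⊎ ¬ Mover x (a j) → Half x y i i′ (b j) ⊎ Half y x i′ i (b j)
    helper (inj₂ ¬mover) = contradiction (j , refl , right) ¬mover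
    helper (inj₁ yaj<ybi′) with y (a j) <? y (b j) | x (b j) <? x (a i) | y (b j) <? y (a i′)
    ... | yes up | _ | _ = contradiction (leftmost j right up yaj<ybi′) (<⇒≱ xaj<xai)
    ... | no ¬up | yes xbj<xai | _ = inj₁ (xbj<xai , inj₁ (≤-<-trans (≮⇒≥ ¬up) yaj<ybi′))
    ... | no ¬up | no _ | yes ybj<yai′ = inj₂ (ybj<yai′ , inj₁ (to x-iso j i xaj<xai))
    -- If `b j` were outside both halves, `a i′` would be no higher than `a j`, hence `b i′` no
    -- higher than `b j`.
    ... | no ¬up | no _ | no ybj≮yai′ =
      contradiction (iso-≤ y-iso i′ j (≤-trans (≮⇒≥ ybj≮yai′) (≮⇒≥ ¬up)))
                    (<⇒≱ (≤-<-trans (≮⇒≥ ¬up) yaj<ybi′))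

-- North-east moves and extremal crossings.

module NorthEast {n r k} {a b : Fin r → Fin n} {x y : Fin n → ℕ} (S : Embeddings k a b x y) where
  open Embeddings S

  x-inj : ∀ {u v} → x u ≡ x v → u ≡ v
  x-inj = Coordinate.injective x-coord

  y-inj : ∀ {u v} → y u ≡ y v → u ≡ v
  y-inj = Coordinate.injective y-coord

  NE : Fin r → Set
  NE i = x (a i) < x (b i) × y (a i) < y (b i)

  ne? : ∀ i → Dec (NE i)
  ne? i = (x (a i) <? x (b i)) ×-dec (y (a i) <? y (b i))

  displacement≤k : ∀ {z} → Coordinate z → OrderIso a b z → ∀ i → z (b i) ≤ z (a i) + k
  displacement≤k {z} coord iso i = begin
    z (b i)                                          ≤⟨ m≤m+n _ _ ⟩
    z (b i) + missed a (below z (z (a i)))           ≡⟨ displacement iso coord a-inj b-inj i ⟩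
    z (a i) + missed b (below z (z (b i)))           ≤⟨ +-monoʳ-≤ (z (a i)) (missed-mono b _ _ (λ w → ⟦⟧≤1 (z w <? z (b i)))) ⟩
    z (a i) + missed b (λ _ → 1)                     ≡⟨ cong (z (a i) +_) (missed-1 b b-inj r+k≡n) ⟩
    z (a i) + k                                      ∎
    where open ≤-Reasoning

  -- Once the relative position is known, the absolute values in `breadth` resolve into an
  -- inequality of coordinate sums without subtraction.
  far-NE : ∀ {u v} → u ≢ v → x u ≤ x v → y u ≤ y v → x u + y u + (k + 2) ≤ x v + y v
  far-NE {u} {v} u≢v xu≤xv yu≤yv = begin
    x u + y u + (k + 2)                              ≤⟨ +-monoʳ-≤ (x u + y u) (breadth u≢v) ⟩
    x u + y u + (∣ x u - x v ∣ + ∣ y u - y v ∣)      ≡⟨ cong₂ (λ s t → x u + y u + (s + t)) (m≤n⇒∣m-n∣≡n∸m xu≤xv) (m≤n⇒∣m-n∣≡n∸m yu≤yv) ⟩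
    x u + y u + ((x v ∸ x u) + (y v ∸ y u))          ≡⟨ swap₂ (x u) (y u) _ _ ⟩
    (x u + (x v ∸ x u)) + (y u + (y v ∸ y u))        ≡⟨ cong₂ _+_ (m+[n∸m]≡n xu≤xv) (m+[n∸m]≡n yu≤yv) ⟩
    x v + y v                                        ∎
    where
    open ≤-Reasoning
    swap₂ : ∀ l m o p → l + m + (o + p) ≡ (l + o) + (m + p)
    swap₂ = solve-∀

  far-SE : ∀ {u v} → u ≢ v → x u ≤ x v → y v ≤ y u → x u + y v + (k + 2) ≤ x v + y u
  far-SE {u} {v} u≢v xu≤xv yv≤yu = begin
    x u + y v + (k + 2)                              ≤⟨ +-monoʳ-≤ (x u + y v) (breadth u≢v) ⟩
    x u + y v + (∣ x u - x v ∣ + ∣ y u - y v ∣)      ≡⟨ cong₂ (λ s t → x u + y v + (s + t)) (m≤n⇒∣m-n∣≡n∸m xu≤xv) (m≤n⇒∣n-m∣≡n∸m yv≤yu) ⟩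
    x u + y v + ((x v ∸ x u) + (y u ∸ y v))          ≡⟨ swap₂ (x u) (y v) _ _ ⟩
    (x u + (x v ∸ x u)) + (y v + (y u ∸ y v))        ≡⟨ cong₂ _+_ (m+[n∸m]≡n xu≤xv) (m+[n∸m]≡n yv≤yu) ⟩
    x v + y u                                        ∎
    where
    open ≤-Reasoning
    swap₂ : ∀ l m o p → l + m + (o + p) ≡ (l + o) + (m + p)
    swap₂ = solve-∀

  -- The movers p = a i → q = b i and p′ = a i′ → q′ = b i′ cross like a plus sign (or coincide).
  record Crossing (i i′ : Fin r) : Set where
    field
      leftmost : ∀ j → NE j → y (a j) < y (b i′) → x (a i) ≤ x (a j)
      lowest   : ∀ j → NE j → x (a j) < x (b i) → y (a i′) ≤ y (a j)
      ne       : NE i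
      ne′      : NE i′
      p′<q     : x (a i′) < x (b i)
      p<q′     : y (a i) < y (b i′)

  Lowest : Fin r → Fin r → Set
  Lowest i i′ = (NE i′ × x (a i′) < x (b i)) × (∀ j → NE j × x (a j) < x (b i) → y (a i′) ≤ y (a j))

  lowest-of : ∀ i → NE i → ∃ (Lowest i)
  lowest-of i ne = argmin (λ j → ne? j ×-dec (x (a j) <? x (b i))) (y ∘ a) (i , ne , proj₁ ne)

  -- While `a i` is not below `b i′`, it is replaced by the leftmost start `a j` of a north-east
  -- move below `b i′`. This lies strictly further right, so the fuel suffices. The new `b j′` is no
  -- higher than `b i′`, which keeps the leftmost condition alive.
  search : ∀ fuel i i′ → NE i → Lowest i i′ →
           (∀ j → NE j → y (a j) < y (b i′) → x (a i) ≤ x (a j)) →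
           Coordinate.top x-coord < x (a i) + fuel → ∃ λ i → ∃ (Crossing i)
  search zero i i′ ne low left bound =
    contradiction (subst (Coordinate.top x-coord <_) (+-identityʳ _) bound) (≤⇒≯ (Coordinate.x≤top x-coord (a i)))
  search (suc fuel) i i′ ne ((ne′ , p′<q) , low) left bound with y (a i) <? y (b i′)
  ... | yes p<q′ = i , i′ , record
    { leftmost = left ; lowest = λ j nej lt → low j (nej , lt) ; ne = ne ; ne′ = ne′ ; p′<q = p′<q ; p<q′ = p<q′ }
  ... | no p≮q′ with argmin (λ j → ne? j ×-dec (y (a j) <? y (b i′))) (x ∘ a) (i′ , ne′ , proj₂ ne′)
  ... | j , (nej , yaj<ybi′) , left-j with lowest-of j nej
  ... | j′ , ((nej′ , lt) , low′) = search fuel j j′ nej ((nej′ , lt) , low′)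
      (λ l nel yal<ybj′ → left-j l (nel , <-≤-trans yal<ybj′ ybj′≤ybi′)) bound′
    where
    xai<xaj : x (a i) < x (a j)
    xai<xaj = ≤∧≢⇒< (left j nej yaj<ybi′) (λ e → p≮q′ (subst (λ z → y z < y (b i′)) (sym (x-inj e)) yaj<ybi′))
    ybj′≤ybi′ : y (b j′) ≤ y (b i′)
    ybj′≤ybi′ = iso-≤ y-iso j′ i′ (low′ i′ (ne′ , <-trans p′<q (to x-iso i j xai<xaj)))
    bound′ : Coordinate.top x-coord < x (a j) + fuel
    bound′ = <-≤-trans bound (≤-trans (≤-reflexive (+-suc (x (a i)) fuel)) (+-monoˡ-≤ fuel xai<xaj))

  crossing : ∃ NE → ∃ λ i → ∃ (Crossing i)
  crossing nei with argmin ne? (x ∘ a) nei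
  ... | i , ne , left with lowest-of i ne
  -- The search starts from the leftmost of all north-east moves, for which the leftmost condition
  -- holds whatever `i′` is.
  ... | i′ , low = search (suc (Coordinate.top x-coord)) i i′ ne low (λ j nej _ → left j nej) (m≤n+m _ (x (a i)))

  -- The rectangle spanned by a crossing.

  module _ {i i′} (X : Crossing i i′) where
    open Crossing X
    p = a i
    q = b i
    p′ = a i′
    q′ = b i′

    xp≤xp′ : x p ≤ x p′
    xp≤xp′ = leftmost i′ ne′ (proj₂ ne′)

    yp′≤yp : y p′ ≤ y p
    yp′≤yp = lowest i ne (proj₁ ne)

    -- Half-open, so that it is exactly what `Zone` leaves over in the quadrant left of `q` and
    -- below `q′`.
    Rect : Fin n → Set
    Rect w = ((x p ≤ x w) × (x w < x q)) × ((y p′ ≤ y w) × (y w < y q′))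

    rect? : ∀ w → Dec (Rect w)
    rect? w = ((x p ≤? x w) ×-dec (x w <? x q)) ×-dec ((y p′ ≤? y w) ×-dec (y w <? y q′))

    -- The distances from `w` to `a j` and `b j` add up to the distance of these two, which is at
    -- most `2 k`; breadth makes the sum at least `2 k + 4`.
    no-between-NE : ∀ j w → x (a j) < x w → x w < x (b j) → y (a j) < y w → y w < y (b j) → ⊥
    no-between-NE j w l₁ l₂ l₃ l₄ = <⇒≱ (m<m+n _ {4} (s≤s z≤n)) (begin
      x (a j) + y (a j) + (k + k) + (x w + y w) + 4
        ≡⟨ e₁ (x (a j)) (y (a j)) (x w) (y w) k ⟩
      (x (a j) + y (a j) + (k + 2)) + (x w + y w + (k + 2))
        ≤⟨ +-mono-≤ (far-NE (λ e → <⇒≢ l₁ (cong x e)) (<⇒≤ l₁) (<⇒≤ l₃)) (far-NE (λ e → <⇒≢ l₂ (cong x e)) (<⇒≤ l₂) (<⇒≤ l₄)) ⟩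
      (x w + y w) + (x (b j) + y (b j))
        ≤⟨ +-monoʳ-≤ (x w + y w) (+-mono-≤ (displacement≤k x-coord x-iso j) (displacement≤k y-coord y-iso j)) ⟩
      (x w + y w) + ((x (a j) + k) + (y (a j) + k))
        ≡⟨ e₂ (x (a j)) (y (a j)) (x w) (y w) k ⟩
      x (a j) + y (a j) + (k + k) + (x w + y w) ∎)
      where
      open ≤-Reasoning
      e₁ : ∀ s t u v k → s + t + (k + k) + (u + v) + 4 ≡ (s + t + (k + 2)) + (u + v + (k + 2))
      e₁ = solve-∀
      e₂ : ∀ s t u v k → (u + v) + ((s + k) + (t + k)) ≡ s + t + (k + k) + (u + v)
      e₂ = solve-∀

    -- Again two distances of at least `k + 2` add up to the distance of the corners, now `p` and
    -- `p′`. Its horizontal part is below that from `p` to `q`, its vertical part below that from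
    -- `p′` to `q′`, and each of these is at most `k`.
    no-between-SE : ∀ w → x p < x w → x w < x p′ → y p′ < y w → y w < y p → ⊥
    no-between-SE w l₁ l₂ l₃ l₄ = <⇒≱ (m<m+n _ {4} (s≤s z≤n)) (begin
      x p + y p′ + (k + k) + (x w + y w) + 4
        ≡⟨ e₁ (x p) (y p′) (x w) (y w) k ⟩
      (x p + y w + (k + 2)) + (x w + y p′ + (k + 2))
        ≤⟨ +-mono-≤ (far-SE (λ e → <⇒≢ l₁ (cong x e)) (<⇒≤ l₁) (<⇒≤ l₄)) (far-SE (λ e → <⇒≢ l₂ (cong x e)) (<⇒≤ l₂) (<⇒≤ l₃)) ⟩
      (x w + y p) + (x p′ + y w)
        ≤⟨ +-mono-≤ (+-monoʳ-≤ (x w) (<⇒≤ p<q′)) (+-monoˡ-≤ (y w) (<⇒≤ p′<q)) ⟩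
      (x w + y q′) + (x q + y w)
        ≤⟨ +-mono-≤ (+-monoʳ-≤ (x w) (displacement≤k y-coord y-iso i′)) (+-monoˡ-≤ (y w) (displacement≤k x-coord x-iso i)) ⟩
      (x w + (y p′ + k)) + ((x p + k) + y w)
        ≡⟨ e₂ (x p) (y p′) (x w) (y w) k ⟩
      x p + y p′ + (k + k) + (x w + y w) ∎)
      where
      open ≤-Reasoning
      e₁ : ∀ s t u v k → s + t + (k + k) + (u + v) + 4 ≡ (s + v + (k + 2)) + (u + t + (k + 2))
      e₁ = solve-∀
      e₂ : ∀ s t u v k → (u + (t + k)) + ((s + k) + v) ≡ s + t + (k + k) + (u + v)
      e₂ = solve-∀

    -- A third point above `p` lies in the box from `p` to `q`, one to the right of `p′` in the box
    -- from `p′` to `q′`, and any other in the box between `p` and `p′`. All three boxes are empty.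
    rect⊆ : ∀ w → Rect w → p ≡ w ⊎ p′ ≡ w
    rect⊆ w ((xp≤xw , xw<xq) , (yp′≤yw , yw<yq′)) with p ≟ᶠ w | p′ ≟ᶠ w
    ... | yes e | _     = inj₁ e
    ... | no _  | yes e = inj₂ e
    ... | no p≢w | no p′≢w = ⊥-elim absurd
      where
      xp<xw : x p < x w
      xp<xw = ≤∧≢⇒< xp≤xw (p≢w ∘ x-inj)
      yp′<yw : y p′ < y w
      yp′<yw = ≤∧≢⇒< yp′≤yw (p′≢w ∘ y-inj)
      absurd : ⊥
      absurd with y p <? y w | x p′ <? x w
      ... | yes yp<yw | _ = no-between-NE i w xp<xw xw<xq yp<yw
                              (<-≤-trans yw<yq′ (iso-≤ y-iso i′ i yp′≤yp))
      ... | no _ | yes xp′<xw = no-between-NE i′ w xp′<xw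
                              (<-≤-trans xw<xq (iso-≤ x-iso i i′ xp≤xp′)) yp′<yw yw<yq′
      ... | no yp≮yw | no xp′≮xw = no-between-SE w xp<xw (≤∧≢⇒< (≮⇒≥ xp′≮xw) (p′≢w ∘ sym ∘ x-inj)) yp′<yw
                                     (≤∧≢⇒< (≮⇒≥ yp≮yw) (p≢w ∘ sym ∘ y-inj))

    Zone : Fin n → Set
    Zone w = Half a b x y i i′ w ⊎ Half a b y x i′ i w

    zone? : ∀ w → Dec (Zone w)
    zone? w = half? a b x y i i′ w ⊎-dec half? a b y x i′ i w

    zone-step : ∀ j → Zone (a j) → Zone (b j)
    zone-step j (inj₁ h) = half-step a b x-iso y-iso i i′ (λ l ri up → leftmost l (ri , up)) j h
    zone-step j (inj₂ h) with half-step a b y-iso x-iso i′ i (λ l up ri → lowest l (ri , up)) j h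
    ... | inj₁ h′ = inj₂ h′
    ... | inj₂ h′ = inj₁ h′

    rect zone : Fin n → ℕ
    rect w = ⟦ rect? w ⟧
    zone w = ⟦ zone? w ⟧

    -- By closure `b` hits the zone at least as often as `a` does, and hits plus misses give the
    -- same total for both.
    zone-missed : missed b zone ≤ missed a zone
    zone-missed = +-cancelˡ-≤ (sum (zone ∘ b)) _ _ (begin
      sum (zone ∘ b) + missed b zone ≡⟨ sum-split b b-inj zone ⟩
      sum zone                       ≡⟨ sym (sum-split a a-inj zone) ⟩
      sum (zone ∘ a) + missed a zone ≤⟨ +-monoˡ-≤ (missed a zone) (sum-mono _ _ (λ j → ⟦⟧-mono (zone? (a j)) (zone? (b j)) (zone-step j))) ⟩
      sum (zone ∘ b) + missed a zone ∎)
      where open ≤-Reasoning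

    -- Two indicators exceed 1 only where both conditions hold, and this quadrant is covered by the
    -- rectangle and the zone.
    cover : ∀ w → below x (x q) w + below y (y q′) w ≤ 1 + (rect w + zone w)
    cover w = split (x w <? x q) (y w <? y q′)
      where
      split : (A? : Dec (x w < x q)) (B? : Dec (y w < y q′)) → ⟦ A? ⟧ + ⟦ B? ⟧ ≤ 1 + (rect w + zone w)
      split (no _)  B?     = ≤-trans (⟦⟧≤1 B?) (m≤m+n 1 _)
      split (yes _) (no _) = m≤m+n 1 _
      split (yes l) (yes l′) = s≤s (⟦⟧-⊎ (yes tt) (rect? w) (zone? w) λ _ → locate)
        where
        locate : Rect w ⊎ Zone w
        locate with x w <? x p | y w <? y p′
        ... | yes xw<xp | _ = inj₂ (inj₁ (xw<xp , inj₁ l′))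
        ... | no _ | yes yw<yp′ = inj₂ (inj₂ (yw<yp′ , inj₁ l))
        ... | no xw≮xp | no yw≮yp′ = inj₁ ((≮⇒≥ xw≮xp , l) , (≮⇒≥ yw≮yp′ , l′))

    -- Adding the two displacement equations leaves `Ex + Ey` to be bounded. Summing `cover` over
    -- the points missed by `b` gives `k`, at most the size of the rectangle, and the zone term; the
    -- latter is at most `Dx + Dy`, because every point of the zone is left of `p` or below `p′`.
    reach : x q + y q′ ≤ x p + y p′ + (k + sum rect)
    reach = +-cancelʳ-≤ (Dx + Dy) _ _ (begin
      x q + y q′ + (Dx + Dy)                    ≡⟨ e₁ (x q) (y q′) Dx Dy ⟩
      (x q + Dx) + (y q′ + Dy)                  ≡⟨ cong₂ _+_ (displacement x-iso x-coord a-inj b-inj i) (displacement y-iso y-coord a-inj b-inj i′) ⟩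
      (x p + Ex) + (y p′ + Ey)                  ≡⟨ e₂ (x p) Ex (y p′) Ey ⟩
      x p + y p′ + (Ex + Ey)                    ≤⟨ +-monoʳ-≤ (x p + y p′) E≤ ⟩
      x p + y p′ + (k + sum rect + (Dx + Dy))   ≡⟨ sym (+-assoc (x p + y p′) (k + sum rect) (Dx + Dy)) ⟩
      x p + y p′ + (k + sum rect) + (Dx + Dy)   ∎)
      where
      open ≤-Reasoning
      Dx = missed a (below x (x p))
      Dy = missed a (below y (y p′))
      Ex = missed b (below x (x q))
      Ey = missed b (below y (y q′))
      e₁ : ∀ s t u v → s + t + (u + v) ≡ (s + u) + (t + v)
      e₁ = solve-∀
      e₂ : ∀ s t u v → (s + t) + (u + v) ≡ s + u + (t + v)
      e₂ = solve-∀
      D≥ : missed a zone ≤ Dx + Dy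
      D≥ = ≤-trans (missed-mono a _ _ (λ w → ⟦⟧-⊎ (zone? w) (x w <? x p) (y w <? y p′)
                      λ { (inj₁ h) → inj₁ (proj₁ h) ; (inj₂ h) → inj₂ (proj₁ h) }))
                   (≤-reflexive (missed-+ a (below x (x p)) (below y (y p′))))
      E≤ : Ex + Ey ≤ k + sum rect + (Dx + Dy)
      E≤ = begin
        Ex + Ey                                              ≡⟨ sym (missed-+ b (below x (x q)) (below y (y q′))) ⟩
        missed b (λ w → below x (x q) w + below y (y q′) w)  ≤⟨ missed-mono b _ _ cover ⟩
        missed b (λ w → 1 + (rect w + zone w))               ≡⟨ missed-+ b (λ _ → 1) (λ w → rect w + zone w) ⟩
        missed b (λ _ → 1) + missed b (λ w → rect w + zone w) ≡⟨ cong₂ _+_ (missed-1 b b-inj r+k≡n) (missed-+ b rect zone) ⟩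
        k + (missed b rect + missed b zone)                  ≤⟨ +-monoʳ-≤ k (+-mono-≤ (missed≤sum b rect) (≤-trans zone-missed D≥)) ⟩
        k + (sum rect + (Dx + Dy))                           ≡⟨ sym (+-assoc k (sum rect) (Dx + Dy)) ⟩
        k + sum rect + (Dx + Dy)                             ∎

    |rect|≤2 : sum rect ≤ 2
    |rect|≤2 = begin
      sum rect                                   ≤⟨ sum-mono _ _ (λ w → ⟦⟧-⊎ (rect? w) (p ≟ᶠ w) (p′ ≟ᶠ w) (rect⊆ w)) ⟩
      sum (λ w → ⟦ p ≟ᶠ w ⟧ + ⟦ p′ ≟ᶠ w ⟧)       ≡⟨ ∑-distrib-+ {n} _ _ ⟩
      sum (λ w → ⟦ p ≟ᶠ w ⟧) + sum (λ w → ⟦ p′ ≟ᶠ w ⟧) ≡⟨ cong₂ _+_ (sum-δ₁ p) (sum-δ₁ p′) ⟩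
      2 ∎
      where open ≤-Reasoning

    |rect|≤1 : i ≡ i′ → sum rect ≤ 1
    |rect|≤1 refl = ≤-trans (sum-mono _ _ (λ w → ⟦⟧-mono (rect? w) (p ≟ᶠ w) λ R → join (rect⊆ w R)))
                            (≤-reflexive (sum-δ₁ p))
      where
      join : ∀ {w} → p ≡ w ⊎ p ≡ w → p ≡ w
      join (inj₁ e) = e
      join (inj₂ e) = e

    no-crossing : ⊥
    no-crossing with i ≟ᶠ i′
    -- The sum for `q` exceeds that for `p` by at least `k + 2` by breadth, but by at most `k + 1`
    -- by `reach`.
    ... | yes refl = <⇒≱ (n<1+n _) (begin
      suc (x p + y p + (k + 1))  ≡⟨ e (x p + y p) k ⟩
      x p + y p + (k + 2)        ≤⟨ far-NE (λ e → <⇒≢ (proj₁ ne) (cong x e)) (<⇒≤ (proj₁ ne)) (<⇒≤ (proj₂ ne)) ⟩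
      x q + y q                  ≤⟨ reach ⟩
      x p + y p + (k + sum rect) ≤⟨ +-monoʳ-≤ (x p + y p) (+-monoʳ-≤ k (|rect|≤1 refl)) ⟩
      x p + y p + (k + 1)        ∎)
      where
      open ≤-Reasoning
      e : ∀ s k → suc (s + (k + 1)) ≡ s + (k + 2)
      e = solve-∀
    -- The two strict inequalities of the crossing raise the lower bound from `k + 2` to `k + 4`,
    -- whereas `reach` allows only `k + 2`.
    ... | no i≢i′ = <⇒≱ (m<m+n _ {2} (s≤s z≤n)) (begin
      x p + y p′ + (k + 2) + 2    ≤⟨ +-monoˡ-≤ 2 (far-SE (i≢i′ ∘ a-inj) xp≤xp′ yp′≤yp) ⟩
      x p′ + y p + 2              ≡⟨ e (x p′) (y p) ⟩
      suc (x p′) + suc (y p)      ≤⟨ +-mono-≤ p′<q p<q′ ⟩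
      x q + y q′                  ≤⟨ reach ⟩
      x p + y p′ + (k + sum rect) ≤⟨ +-monoʳ-≤ (x p + y p′) (+-monoʳ-≤ k |rect|≤2) ⟩
      x p + y p′ + (k + 2)        ∎)
      where
      open ≤-Reasoning
      e : ∀ s t → s + t + 2 ≡ suc s + suc t
      e = solve-∀

  no-NE : ∀ i → ¬ NE i
  no-NE i ne = let _ , _ , X = crossing (i , ne) in no-crossing X

-- Reflection, and the other three directions.

-- Adding `n + m` to both arguments clears the truncated subtractions, leaving `n + t` and `m + t`.
∣top∸-∣ : ∀ {t m n} → m ≤ t → n ≤ t → ∣ t ∸ m - t ∸ n ∣ ≡ ∣ m - n ∣
∣top∸-∣ {t} {m} {n} m≤t n≤t = begin
  ∣ t ∸ m - t ∸ n ∣                              ≡⟨ sym (∣m+n-m+o∣≡∣n-o∣ (n + m) _ _) ⟩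
  ∣ n + m + (t ∸ m) - n + m + (t ∸ n) ∣          ≡⟨ cong₂ ∣_-_∣ (trans (+-assoc n m _) (cong (n +_) (m+[n∸m]≡n m≤t)))
                                                     (trans (trans (cong (_+ (t ∸ n)) (+-comm n m)) (+-assoc m n _)) (cong (m +_) (m+[n∸m]≡n n≤t))) ⟩
  ∣ n + t - m + t ∣                              ≡⟨ cong₂ ∣_-_∣ (+-comm n t) (+-comm m t) ⟩
  ∣ t + n - t + m ∣                              ≡⟨ ∣m+n-m+o∣≡∣n-o∣ t n m ⟩
  ∣ n - m ∣                                      ≡⟨ ∣-∣-comm n m ⟩
  ∣ m - n ∣                                      ∎
  where open ≡-Reasoning

module Flip {n} {x : Fin n → ℕ} (coord : Coordinate x) where
  open Coordinate coord

  flip : Fin n → ℕ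
  flip w = top ∸ x w

  flip-< : ∀ {u v} → x u < x v → flip v < flip u
  flip-< {v = v} lt = ∸-monoʳ-< lt (x≤top v)

  -- Every point is below `u`, above `u`, or `u` itself; the last case accounts for the 1.
  complement : ∀ u → sum (below x (x u)) + sum (below flip (flip u)) + 1 ≡ n
  complement u = begin
    sum (below x (x u)) + sum (below flip (flip u)) + 1
      ≡⟨ cong₂ _+_ (sym (∑-distrib-+ {n} _ _)) (sym (sum-δ₁ u)) ⟩
    sum (λ w → below x (x u) w + below flip (flip u) w) + sum (λ w → ⟦ u ≟ᶠ w ⟧)
      ≡⟨ sym (∑-distrib-+ {n} _ _) ⟩
    sum (λ w → below x (x u) w + below flip (flip u) w + ⟦ u ≟ᶠ w ⟧)
      ≡⟨ sum-cong-≗ trichotomy ⟩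
    sum {n} (λ _ → 1)
      ≡⟨ sum-1 n ⟩
    n ∎
    where
    open ≡-Reasoning
    trichotomy : ∀ w → below x (x u) w + below flip (flip u) w + ⟦ u ≟ᶠ w ⟧ ≡ 1
    trichotomy w with <-cmp (x w) (x u)
    ... | tri< lt ¬e _ rewrite ⟦⟧-yes (x w <? x u) lt
                             | ⟦⟧-no (flip w <? flip u) (<⇒≯ (flip-< lt))
                             | ⟦⟧-no (u ≟ᶠ w) (λ e → ¬e (cong x (sym e))) = refl
    ... | tri≈ ¬l e ¬g rewrite ⟦⟧-no (x w <? x u) ¬l
                             | ⟦⟧-no (flip w <? flip u) (λ lt → ¬g (∸-cancelʳ-< lt))
                             | ⟦⟧-yes (u ≟ᶠ w) (injective (sym e)) = refl
    ... | tri> ¬l ¬e gt rewrite ⟦⟧-no (x w <? x u) ¬l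
                             | ⟦⟧-yes (flip w <? flip u) (flip-< gt)
                             | ⟦⟧-no (u ≟ᶠ w) (λ e → ¬e (cong x (sym e))) = refl

  flip-coordinate : Coordinate flip
  flip-coordinate = record
    { injective = λ {u} {v} e → injective (∸-cancelˡ-≡ (x≤top u) (x≤top v) e)
    ; top       = top
    ; x≤top     = λ u → m∸n≤m top (x u)
    -- With `x u + B v + 1` added, both sides become `top + n`.
    ; rank      = λ u v → +-cancelʳ-≡ (x u + B v + 1) _ _ (begin
        flip v + A u + (x u + B v + 1)    ≡⟨ cong (λ z → flip v + A u + (z + 1)) (sym (rank u v)) ⟩
        flip v + A u + (x v + B u + 1)    ≡⟨ e₁ (flip v) (A u) (x v) (B u) ⟩
        (x v + flip v) + (B u + A u + 1)  ≡⟨ cong₂ _+_ (m+[n∸m]≡n (x≤top v)) (complement u) ⟩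
        top + n                           ≡⟨ sym (cong₂ _+_ (m+[n∸m]≡n (x≤top u)) (complement v)) ⟩
        (x u + flip u) + (B v + A v + 1)  ≡⟨ sym (e₁ (flip u) (A v) (x u) (B v)) ⟩
        flip u + A v + (x u + B v + 1)    ∎)
    }
    where
    open ≡-Reasoning
    A B : Fin n → ℕ
    A u = sum (below flip (flip u))
    B u = sum (below x (x u))
    e₁ : ∀ s t u v → s + t + (u + v + 1) ≡ (u + s) + (v + t + 1)
    e₁ = solve-∀

  flip-iso : ∀ {r} {a b : Fin r → Fin n} → OrderIso a b x → OrderIso a b flip
  flip-iso iso = record
    { to   = λ i j lt → flip-< (to iso j i (∸-cancelʳ-< lt))
    ; from = λ i j lt → flip-< (from iso j i (∸-cancelʳ-< lt))
    }

iso-sym : ∀ {r n} {a b : Fin r → Fin n} {x} → OrderIso a b x → OrderIso b a x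
iso-sym iso = record { to = from iso ; from = to iso }

swap-embeddings : ∀ {n r k} {a b : Fin r → Fin n} {x y} → Embeddings k a b x y → Embeddings k b a x y
swap-embeddings S = record
  { r+k≡n = r+k≡n ; a-inj = b-inj ; b-inj = a-inj ; x-coord = x-coord ; y-coord = y-coord
  ; x-iso = iso-sym x-iso ; y-iso = iso-sym y-iso ; breadth = breadth }
  where open Embeddings S

flip-embeddings : ∀ {n r k} {a b : Fin r → Fin n} {x y} (S : Embeddings k a b x y) →
                  Embeddings k a b x (Flip.flip (Embeddings.y-coord S))
flip-embeddings {k = k} {x = x} {y} S = record
  { r+k≡n = r+k≡n ; a-inj = a-inj ; b-inj = b-inj ; x-coord = x-coord ; y-coord = flip-coordinate
  ; x-iso = x-iso ; y-iso = flip-iso y-iso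
  ; breadth = λ {u} {v} u≢v → subst (λ z → k + 2 ≤ ∣ x u - x v ∣ + z)
                (sym (∣top∸-∣ (Coordinate.x≤top y-coord u) (Coordinate.x≤top y-coord v))) (breadth u≢v) }
  where
  open Embeddings S
  open Flip y-coord

embeddings-agree : ∀ {n r k} {a b : Fin r → Fin n} {x y} → Embeddings k a b x y → ∀ i → a i ≡ b i
embeddings-agree {a = a} {b} {x} {y} S i with <-cmp (x (a i)) (x (b i)) | <-cmp (y (a i)) (y (b i))
... | tri≈ _ e _ | _            = Coordinate.injective (Embeddings.x-coord S) e
... | _          | tri≈ _ e _   = Coordinate.injective (Embeddings.y-coord S) e
... | tri< l _ _ | tri< l′ _ _  = contradiction (l , l′) (NorthEast.no-NE S i)
... | tri> _ _ g | tri> _ _ g′  = contradiction (g , g′) (NorthEast.no-NE (swap-embeddings S) i)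
-- South-east becomes north-east by reflecting `y`; north-west needs the exchange of `a` and `b` as
-- well.
... | tri< l _ _ | tri> _ _ g′  =
  contradiction (l , Flip.flip-< (Embeddings.y-coord S) g′) (NorthEast.no-NE (flip-embeddings S) i)
... | tri> _ _ g | tri< l′ _ _  =
  contradiction (g , Flip.flip-< (Embeddings.y-coord S) l′) (NorthEast.no-NE (swap-embeddings (flip-embeddings S)) i)

-- Ranks of the entries of lists and permutations.

sum-mono-< : ∀ {n} (f g : Fin n → ℕ) → (∀ i → f i ≤ g i) → ∀ i → f i < g i → sum f < sum g
sum-mono-< f g f≤g zero    lt = +-mono-<-≤ lt (sum-mono (f ∘ suc) (g ∘ suc) (f≤g ∘ suc))
sum-mono-< f g f≤g (suc i) lt = +-mono-≤-< (f≤g zero) (sum-mono-< (f ∘ suc) (g ∘ suc) (f≤g ∘ suc) i lt)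

sum-cast : ∀ {m n} (eq : m ≡ n) (f : Fin m → ℕ) (g : Fin n → ℕ) → (∀ i → f i ≡ g (cast eq i)) → sum f ≡ sum g
sum-cast refl f g f≗g = sum-cong-≗ (λ i → trans (f≗g i) (cong g (cast-is-id refl i)))

sum-below-toℕ : ∀ {n} (u : Fin n) → sum {n} (below toℕ (toℕ u)) ≡ toℕ u
sum-below-toℕ {suc n} zero = trans (sum-cong-≗ {n} (λ _ → refl)) (sum-replicate-zero n)
sum-below-toℕ {suc n} (suc u) = cong suc (trans (sum-cong-≗ {n} λ w →
  ⟦⟧-cong (suc (toℕ w) <? suc (toℕ u)) (toℕ w <? toℕ u) ≤-pred s≤s) (sum-below-toℕ u))

toℕ-coordinate : ∀ {n} → Coordinate {n} toℕ
toℕ-coordinate {n} = record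
  { injective = toℕ-injective
  ; top       = n
  ; x≤top     = λ u → <⇒≤ (toℕ<n u)
  ; rank      = λ u v → trans (cong (toℕ v +_) (sum-below-toℕ u))
                  (trans (+-comm (toℕ v) (toℕ u)) (cong (toℕ u +_) (sym (sum-below-toℕ v))))
  }

count : List ℕ → ℕ → ℕ
count xs v = sum (below (lookup xs) v)

∈-lookup⁻ : ∀ {A : Set} {xs : List A} {v} → v ∈ xs → ∃ λ i → v ≡ lookup xs i
∈-lookup⁻ v∈ = index v∈ , lookup-index v∈

count-↭ : ∀ {xs ys} → xs ↭ ys → ∀ v → count xs v ≡ count ys v
count-↭ refl          v = refl
count-↭ (prep x p)    v = cong (⟦ x <? v ⟧ +_) (count-↭ p v)
count-↭ (swap {ys = ys} x y p)  v = trans (cong (λ z → ⟦ x <? v ⟧ + (⟦ y <? v ⟧ + z)) (count-↭ p v))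
  (exchange ⟦ x <? v ⟧ ⟦ y <? v ⟧ (count ys v))
  where
  exchange : ∀ l m o → l + (m + o) ≡ m + (l + o)
  exchange = solve-∀
count-↭ (↭-step p q)   v = trans (count-↭ p v) (count-↭ q v)

count-applyUpTo-≥ : ∀ f r {c} → (∀ i → c ≤ f i) → count (applyUpTo f r) c ≡ 0
count-applyUpTo-≥ f zero    c≤f = refl
count-applyUpTo-≥ f (suc r) {c} c≤f =
  cong₂ _+_ (⟦⟧-no (f 0 <? c) (≤⇒≯ (c≤f 0))) (count-applyUpTo-≥ (f ∘ suc) r (c≤f ∘ suc))

-- Stated for every increasing `f` because the induction passes to `f ∘ suc`.
count-applyUpTo : ∀ f r → (∀ {i j} → i < j → f i < f j) → ∀ {v} → v ≤ r → count (applyUpTo f r) (f v) ≡ v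
count-applyUpTo f zero    mono z≤n = refl
count-applyUpTo f (suc r) mono {zero}  _ = count-applyUpTo-≥ f (suc r) λ { zero → ≤-refl ; (suc i) → <⇒≤ (mono (s≤s z≤n)) }
count-applyUpTo f (suc r) mono {suc v} (s≤s v≤r) =
  cong₂ _+_ (⟦⟧-yes (f 0 <? f (suc v)) (mono (s≤s z≤n))) (count-applyUpTo (f ∘ suc) r (λ lt → mono (s≤s lt)) v≤r)

∈-range1⁻ : ∀ {r v} → v ∈ range1 r → ∃ λ u → u < r × v ≡ suc u
∈-range1⁻ v∈ with ∈-map⁻ suc v∈
... | u , u∈ , v≡ = u , ∈-upTo⁻ u∈ , v≡

∈-range1⁺ : ∀ {r u} → u < r → suc u ∈ range1 r
∈-range1⁺ u<r = ∈-map⁺ suc (∈-upTo⁺ u<r)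

length-range1 : ∀ r → length (range1 r) ≡ r
length-range1 r = trans (length-map suc (upTo r)) (length-upTo r)

perm-length : ∀ {r π} → IsPerm r π → length π ≡ r
perm-length {r} π-perm = trans (↭-length π-perm) (length-range1 r)

-- `count` is invariant under rearrangement, so it can be evaluated on the sorted list.
perm-count : ∀ {r π v} → IsPerm r π → v ∈ π → suc (count π v) ≡ v
perm-count {r} {π} π-perm v∈ with ∈-range1⁻ (∈-resp-↭ π-perm v∈)
... | u , u<r , refl = cong suc (begin
  count π (suc u)                    ≡⟨ count-↭ π-perm (suc u) ⟩
  count (range1 r) (suc u)           ≡⟨ cong (λ l → count l (suc u)) (map-upTo suc r) ⟩
  count (applyUpTo suc r) (suc u)    ≡⟨ count-applyUpTo suc r s≤s (<⇒≤ u<r) ⟩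
  u                                  ∎)
  where open ≡-Reasoning

range1-unique : ∀ r → Unique (range1 r)
range1-unique r = Uniqueₚ.map⁺ suc-injective (Uniqueₚ.upTo⁺ r)

perm-unique : ∀ {r π} → IsPerm r π → Unique π
perm-unique {r} π-perm = Unique-resp-↭ (setoid ℕ) (↭⇒↭ₛ (↭-sym π-perm)) (range1-unique r)

lookup-injective : ∀ {A : Set} {xs : List A} → Unique xs → ∀ i j → lookup xs i ≡ lookup xs j → i ≡ j
lookup-injective (x∉ ∷ u) zero    zero    e = refl
lookup-injective (x∉ ∷ u) zero    (suc j) e = contradiction e (All.lookup x∉ (∈-lookup j))
lookup-injective (x∉ ∷ u) (suc i) zero    e = contradiction (sym e) (All.lookup x∉ (∈-lookup i))
lookup-injective (x∉ ∷ u) (suc i) (suc j) e = cong suc (lookup-injective u i j e)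

unique-map : ∀ {A B : Set} {f : A → B} {xs} → (∀ {x y} → x ∈ xs → y ∈ xs → f x ≡ f y → x ≡ y) →
             Unique xs → Unique (map f xs)
unique-map inj []       = []
unique-map inj (x∉ ∷ u) =
  Allₚ.map⁺ (All.tabulate (λ y∈ e → All.lookup x∉ y∈ (inj (here refl) (there y∈) e)))
  ∷ unique-map (λ x∈ y∈ → inj (there x∈) (there y∈)) u

-- Pigeonhole principle: the head of `xs` is removed from `ys`, and since it does not recur in `xs`,
-- the tail still lies in what remains.
unique⇒↭ : ∀ {A : Set} {xs ys : List A} → Unique xs → (∀ {v} → v ∈ xs → v ∈ ys) → length ys ≤ length xs → xs ↭ ys
unique⇒↭ {ys = []}    []       sub le = refl
unique⇒↭ {xs = x ∷ xs} {ys} (x∉ ∷ u) sub le with ∈-∃++ (sub (here refl))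
... | l , r , refl = ↭-step (prep x (unique⇒↭ u sub′ le′)) (↭-sym (shift x l r))
  where
  sub′ : ∀ {v} → v ∈ xs → v ∈ l ++ r
  sub′ v∈ with ∈-resp-↭ (shift x l r) (sub (there v∈))
  ... | here refl = contradiction refl (All.lookup x∉ v∈)
  ... | there v∈′ = v∈′
  le′ : length (l ++ r) ≤ length xs
  le′ = ≤-pred (subst (_≤ suc (length xs)) (↭-length (shift x l r)) le)

perm-coordinate : ∀ {r π} → IsPerm r π → Coordinate (lookup π)
perm-coordinate {r} {π} π-perm = record
  { injective = λ {u} {v} → lookup-injective (perm-unique π-perm) u v
  ; top       = r
  ; x≤top     = λ u → bounded u
  ; rank      = λ u v → begin
      lookup π v + count π (lookup π u)            ≡⟨ cong (_+ count π (lookup π u)) (value v) ⟩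
      suc (count π (lookup π v)) + count π (lookup π u) ≡⟨ cong suc (+-comm (count π (lookup π v)) _) ⟩
      suc (count π (lookup π u)) + count π (lookup π v) ≡⟨ cong (_+ count π (lookup π v)) (sym (value u)) ⟩
      lookup π u + count π (lookup π v)            ∎
  }
  where
  open ≡-Reasoning
  value : ∀ u → lookup π u ≡ suc (count π (lookup π u))
  value u = sym (perm-count π-perm (∈-lookup u))
  bounded : ∀ u → lookup π u ≤ r
  bounded u with ∈-range1⁻ (∈-resp-↭ π-perm (∈-lookup u))
  ... | w , w<r , e = subst (_≤ r) (sym e) w<r

-- Standardisation.

map-lookup-cong : ∀ {A B C : Set} {f : A → C} {g : B → C} xs ys (eq : length xs ≡ length ys) →
                  (∀ i → f (lookup xs i) ≡ g (lookup ys (cast eq i))) → map f xs ≡ map g ys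
map-lookup-cong []       []       eq h = refl
map-lookup-cong (x ∷ xs) (y ∷ ys) eq h = cong₂ _∷_ (h zero) (map-lookup-cong xs ys (suc-injective eq) (h ∘ suc))

lookup-ext : ∀ {A : Set} {xs ys : List A} (eq : length xs ≡ length ys) →
             (∀ i → lookup xs i ≡ lookup ys (cast eq i)) → xs ≡ ys
lookup-ext {xs = xs} {ys} eq h = trans (sym (map-id xs)) (trans (map-lookup-cong xs ys eq h) (map-id ys))

lookup-map : ∀ {A B : Set} (f : A → B) xs .(eq : length xs ≡ length (map f xs)) i →
             lookup (map f xs) (cast eq i) ≡ f (lookup xs i)
lookup-map f (x ∷ xs) eq zero    = refl
lookup-map f (x ∷ xs) eq (suc i) = lookup-map f xs (suc-injective eq) i

-- The canonical representative of an order class: it lies in the class by `standardise-order`,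
-- depends only on it by `standardise-cong`, and is the identity on permutations by
-- `standardise-perm`.
standardise : List ℕ → List ℕ
standardise xs = map (λ v → suc (count xs v)) xs

standardise-perm : ∀ {r π} → IsPerm r π → standardise π ≡ π
standardise-perm π-perm = map-id-local (All.tabulate (perm-count π-perm))

standardise-cong : ∀ {xs ys} → SameOrder xs ys → standardise xs ≡ standardise ys
standardise-cong {xs} {ys} (eq , iso) = map-lookup-cong xs ys eq λ i → cong suc (sum-cast eq _ _ λ j →
  ⟦⟧-cong (lookup xs j <? lookup xs i) (lookup ys (cast eq j) <? lookup ys (cast eq i))
    (Equivalence.to (iso j i)) (Equivalence.from (iso j i)))

count-mono : ∀ xs {v w} → v ≤ w → count xs v ≤ count xs w
count-mono xs {v} {w} v≤w = sum-mono _ _ (λ j → ⟦⟧-mono (lookup xs j <? v) (lookup xs j <? w) (λ lt → <-≤-trans lt v≤w))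

-- Strictness comes from entry `i` itself, which counts on the right only.
count-mono-< : ∀ xs i {w} → lookup xs i < w → count xs (lookup xs i) < count xs w
count-mono-< xs i {w} lt = sum-mono-< _ _
  (λ j → ⟦⟧-mono (lookup xs j <? lookup xs i) (lookup xs j <? w) (λ lt′ → <-trans lt′ lt)) i
  (subst₂ _<_ (sym (⟦⟧-no (lookup xs i <? lookup xs i) (<-irrefl refl))) (sym (⟦⟧-yes (lookup xs i <? w) lt)) (s≤s z≤n))

count<length : ∀ xs i → count xs (lookup xs i) < length xs
count<length xs i = subst (count xs (lookup xs i) <_) (sum-1 (length xs)) (sum-mono-< _ (λ _ → 1)
  (λ j → ⟦⟧≤1 (lookup xs j <? lookup xs i)) i
  (subst (_< 1) (sym (⟦⟧-no (lookup xs i <? lookup xs i) (<-irrefl refl))) (s≤s z≤n)))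

standardise-order : ∀ xs → SameOrder xs (standardise xs)
standardise-order xs = eq , λ i j → mk⇔
    (λ lt → subst₂ _<_ (sym (value i)) (sym (value j)) (s≤s (count-mono-< xs i lt)))
    (λ lt → ≰⇒> (λ le → <⇒≱ (subst₂ _<_ (value i) (value j) lt) (s≤s (count-mono xs le))))
  where
  eq : length xs ≡ length (standardise xs)
  eq = sym (length-map _ xs)
  value : ∀ i → lookup (standardise xs) (cast eq i) ≡ suc (count xs (lookup xs i))
  value = lookup-map _ xs eq

standardise-isPerm : ∀ {xs} → Unique xs → IsPerm (length xs) (standardise xs)
standardise-isPerm {xs} u = unique⇒↭ (unique-map inj u) sub
    (≤-reflexive (trans (length-range1 (length xs)) (sym (length-map _ xs))))
  where
  inj : ∀ {v w} → v ∈ xs → w ∈ xs → suc (count xs v) ≡ suc (count xs w) → v ≡ w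
  inj v∈ w∈ e with ∈-lookup⁻ v∈ | ∈-lookup⁻ w∈
  ... | i , refl | j , refl = ≤-antisym (≮⇒≥ (λ lt → <⇒≢ (count-mono-< xs j lt) (sym (suc-injective e))))
                                        (≮⇒≥ (λ lt → <⇒≢ (count-mono-< xs i lt) (suc-injective e)))
  sub : ∀ {v} → v ∈ standardise xs → v ∈ range1 (length xs)
  sub v∈ with ∈-map⁻ _ v∈
  ... | w , w∈ , refl with ∈-lookup⁻ w∈
  ... | i , refl = ∈-range1⁺ (count<length xs i)

-- Sublists and their enumeration by length.

module _ {A : Set} where

  embed : ∀ {s xs : List A} → s ⊆ xs → Fin (length s) → Fin (length xs)
  embed (y ∷ʳ τ) i       = suc (embed τ i)
  embed (_ ∷ τ)  zero    = zero
  embed (_ ∷ τ)  (suc i) = suc (embed τ i)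

  lookup-embed : ∀ {s xs : List A} (τ : s ⊆ xs) i → lookup xs (embed τ i) ≡ lookup s i
  lookup-embed (y ∷ʳ τ)   i       = lookup-embed τ i
  lookup-embed (refl ∷ τ) zero    = refl
  lookup-embed (refl ∷ τ) (suc i) = lookup-embed τ i

  embed-mono : ∀ {s xs : List A} (τ : s ⊆ xs) {i j} → toℕ i < toℕ j → toℕ (embed τ i) < toℕ (embed τ j)
  embed-mono (y ∷ʳ τ) lt = s≤s (embed-mono τ lt)
  embed-mono (_ ∷ τ) {zero}  {suc j} lt       = s≤s z≤n
  embed-mono (_ ∷ τ) {suc i} {suc j} (s≤s lt) = s≤s (embed-mono τ lt)

  embed-cancel : ∀ {s xs : List A} (τ : s ⊆ xs) {i j} → toℕ (embed τ i) < toℕ (embed τ j) → toℕ i < toℕ j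
  embed-cancel τ {i} {j} lt with <-cmp (toℕ i) (toℕ j)
  ... | tri< l _ _ = l
  ... | tri≈ _ e _ = contradiction (cong (toℕ ∘ embed τ) (toℕ-injective e)) (<⇒≢ lt)
  ... | tri> _ _ g = contradiction (embed-mono τ g) (<⇒≯ lt)

  embed-injective : ∀ {s xs : List A} (τ : s ⊆ xs) {i j} → embed τ i ≡ embed τ j → i ≡ j
  embed-injective τ {i} {j} e with <-cmp (toℕ i) (toℕ j)
  ... | tri< l _ _  = contradiction (cong toℕ e) (<⇒≢ (embed-mono τ l))
  ... | tri≈ _ e′ _ = toℕ-injective e′
  ... | tri> _ _ g  = contradiction (cong toℕ (sym e)) (<⇒≢ (embed-mono τ g))

  combinations : ℕ → List A → List (List A)
  combinations zero    xs       = [] ∷ []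
  combinations (suc r) []       = []
  combinations (suc r) (x ∷ xs) = map (x ∷_) (combinations r xs) ++ combinations (suc r) xs

  length-combinations : ∀ r (xs : List A) → length (combinations r xs) ≡ length xs C r
  length-combinations zero    xs       = sym (trans (nCk≡nC[n∸k] {0} {length xs} z≤n) (nCn≡1 (length xs)))
  length-combinations (suc r) []       = refl
  length-combinations (suc r) (x ∷ xs) = begin
    length (map (x ∷_) (combinations r xs) ++ combinations (suc r) xs) ≡⟨ length-++ (map (x ∷_) (combinations r xs)) ⟩
    length (map (x ∷_) (combinations r xs)) + length (combinations (suc r) xs)
      ≡⟨ cong₂ _+_ (trans (length-map (x ∷_) (combinations r xs)) (length-combinations r xs)) (length-combinations (suc r) xs) ⟩
    length xs C r + length xs C suc r ≡⟨ nCk+nC[k+1]≡[n+1]C[k+1] (length xs) r ⟩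
    suc (length xs) C suc r ∎
    where open ≡-Reasoning

  combinations⁻ : ∀ r (xs : List A) {s} → s ∈ combinations r xs → s ⊆ xs × length s ≡ r
  combinations⁻ zero    xs       (here refl) = minimum xs , refl
  combinations⁻ (suc r) (x ∷ xs) s∈ with ∈-++⁻ (map (x ∷_) (combinations r xs)) s∈
  ... | inj₂ s∈′ = let τ , e = combinations⁻ (suc r) xs s∈′ in x ∷ʳ τ , e
  ... | inj₁ s∈′ with ∈-map⁻ (x ∷_) s∈′
  ... | t , t∈ , refl = let τ , e = combinations⁻ r xs t∈ in refl ∷ τ , cong suc e

  combinations⁺ : ∀ {xs s : List A} → s ⊆ xs → s ∈ combinations (length s) xs
  combinations⁺ []                 = here refl
  combinations⁺ {s = []}    (y ∷ʳ τ) = here refl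
  combinations⁺ {s = _ ∷ s} (_∷ʳ_ {ys = ys} y τ) = ∈-++⁺ʳ (map (y ∷_) (combinations (length s) ys)) (combinations⁺ τ)
  combinations⁺ (refl ∷ τ)         = ∈-++⁺ˡ (∈-map⁺ (_ ∷_) (combinations⁺ τ))

  -- The two families are disjoint because one has `x` in every member, while members of the other
  -- are sublists of `xs`, where `x` does not occur.
  combinations-unique : ∀ r {xs : List A} → Unique xs → Unique (combinations r xs)
  combinations-unique zero    u = [] ∷ []
  combinations-unique (suc r) {[]}     u = []
  combinations-unique (suc r) {x ∷ xs} (x∉ ∷ u) =
    Uniqueₚ.++⁺ (Uniqueₚ.map⁺ ∷-injectiveʳ (combinations-unique r u)) (combinations-unique (suc r) u) disjoint
    where
    disjoint : ∀ {s} → ¬ (s ∈ map (x ∷_) (combinations r xs) × s ∈ combinations (suc r) xs)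
    disjoint (s∈ , s∈′) with ∈-map⁻ (x ∷_) s∈
    ... | t , t∈ , refl = All.lookup x∉ (⊆-lookup (proj₁ (combinations⁻ (suc r) xs s∈′)) (here refl)) refl

  unique-⊆ : ∀ {s xs : List A} → s ⊆ xs → Unique xs → Unique s
  unique-⊆ []         u        = u
  unique-⊆ (y ∷ʳ τ)   (_ ∷ u)  = unique-⊆ τ u
  unique-⊆ (refl ∷ τ) (x∉ ∷ u) = All.tabulate (λ y∈ → All.lookup x∉ (⊆-lookup τ y∈)) ∷ unique-⊆ τ u

-- From breadth to the number of patterns.

Breadth≥ : ℕ → List ℕ → Set
Breadth≥ d xs = ∀ {i j : Fin (length xs)} → i ≢ j → d ≤ ∣ toℕ i - toℕ j ∣ + ∣ lookup xs i - lookup xs j ∣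

module _ {n k : ℕ} {xs : List ℕ} (xs-perm : IsPerm n xs) (far : Breadth≥ (k + 2) xs) where

  module Occurrence {s} π (τ : s ⊆ xs) (o : SameOrder s π) where

    eq : length s ≡ length π
    eq = proj₁ o

    -- Indexed by the positions of `π`, so that two occurrences of `π` are maps on the same domain,
    -- as `Embeddings` requires.
    occurrence : Fin (length π) → Fin (length xs)
    occurrence i = embed τ (cast (sym eq) i)

    position : ∀ i j → toℕ (occurrence i) < toℕ (occurrence j) ⇔ toℕ i < toℕ j
    position i j = mk⇔
      (subst₂ _<_ (toℕ-cast (sym eq) i) (toℕ-cast (sym eq) j) ∘ embed-cancel τ)
      (embed-mono τ ∘ subst₂ _<_ (sym (toℕ-cast (sym eq) i)) (sym (toℕ-cast (sym eq) j)))

    value : ∀ i j → lookup xs (occurrence i) < lookup xs (occurrence j) ⇔ lookup π i < lookup π j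
    value i j = subst₂ _⇔_
      (sym (cong₂ _<_ (lookup-embed τ _) (lookup-embed τ _)))
      (cong₂ (λ i′ j′ → lookup π i′ < lookup π j′) (cast-involutive eq (sym eq) i) (cast-involutive eq (sym eq) j))
      (proj₂ o (cast (sym eq) i) (cast (sym eq) j))

    injective : Injective occurrence
    injective {i} {j} e = toℕ-injective
      (trans (sym (toℕ-cast (sym eq) i)) (trans (cong toℕ (embed-injective τ e)) (toℕ-cast (sym eq) j)))

  occurrence-unique : ∀ {s t} π → length π + k ≡ n → s ⊆ xs → t ⊆ xs → SameOrder s π → SameOrder t π → s ≡ t
  occurrence-unique {s} {t} π r+k≡n τ υ o o′ =
    lookup-ext (trans P.eq (sym Q.eq)) λ i → begin
      lookup s i                                   ≡⟨ cong (lookup s) (sym (cast-involutive (sym P.eq) P.eq i)) ⟩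
      lookup s (cast (sym P.eq) (cast P.eq i))     ≡⟨ sym (lookup-embed τ _) ⟩
      lookup xs (P.occurrence (cast P.eq i))       ≡⟨ cong (lookup xs) (embeddings-agree S (cast P.eq i)) ⟩
      lookup xs (Q.occurrence (cast P.eq i))       ≡⟨ lookup-embed υ _ ⟩
      lookup t (cast (sym Q.eq) (cast P.eq i))     ≡⟨ cong (lookup t) (cast-trans P.eq (sym Q.eq) i) ⟩
      lookup t (cast (trans P.eq (sym Q.eq)) i)    ∎
    where
    module P = Occurrence π τ o
    module Q = Occurrence π υ o′
    open ≡-Reasoning
    open Equivalence
    S : Embeddings k P.occurrence Q.occurrence toℕ (lookup xs)
    S = record
      { r+k≡n   = trans r+k≡n (sym (perm-length xs-perm))
      ; a-inj   = P.injective
      ; b-inj   = Q.injective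
      ; x-coord = toℕ-coordinate
      ; y-coord = perm-coordinate xs-perm
      ; x-iso   = record
        { to   = λ i j → from (Q.position i j) ∘ to (P.position i j)
        ; from = λ i j → from (P.position i j) ∘ to (Q.position i j) }
      ; y-iso   = record
        { to   = λ i j → from (Q.value i j) ∘ to (P.value i j)
        ; from = λ i j → from (P.value i j) ∘ to (Q.value i j) }
      ; breadth = far
      }

  -- Standardisation is injective on the sublists of length `r`: two with the same standardisation
  -- are occurrences of one pattern, hence equal by `occurrence-unique`. So there are as many
  -- patterns as sublists.
  patternCount : ∀ {r} → r + k ≡ n → PatternCount r xs (n C k)
  patternCount {r} r+k≡n = map standardise (combinations r xs) ,
      unique-map inj (combinations-unique r xs-unique) ,
      size ,
      λ π → mk⇔ sound complete
    where
    xs-unique : Unique xs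
    xs-unique = perm-unique xs-perm

    inj : ∀ {s t} → s ∈ combinations r xs → t ∈ combinations r xs → standardise s ≡ standardise t → s ≡ t
    inj {s} {t} s∈ t∈ e with combinations⁻ r xs s∈ | combinations⁻ r xs t∈
    ... | τ , |s|≡r | υ , _ = occurrence-unique (standardise s)
      (trans (cong (_+ k) (trans (length-map _ s) |s|≡r)) r+k≡n) τ υ
      (standardise-order s) (subst (SameOrder t) (sym e) (standardise-order t))

    size : length (map standardise (combinations r xs)) ≡ n C k
    size = begin
      length (map standardise (combinations r xs)) ≡⟨ length-map standardise (combinations r xs) ⟩
      length (combinations r xs)                   ≡⟨ length-combinations r xs ⟩
      length xs C r                                ≡⟨ cong (_C r) (perm-length xs-perm) ⟩
      n C r                                        ≡⟨ nCk≡nC[n∸k] (subst (r ≤_) r+k≡n (m≤m+n r k)) ⟩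
      n C (n ∸ r)                                  ≡⟨ cong (λ z → n C (z ∸ r)) (sym r+k≡n) ⟩
      n C (r + k ∸ r)                              ≡⟨ cong (n C_) (m+n∸m≡n r k) ⟩
      n C k                                        ∎
      where open ≡-Reasoning

    sound : ∀ {π} → π ∈ map standardise (combinations r xs) → IsPerm r π × π ≼ xs
    sound π∈ with ∈-map⁻ standardise π∈
    ... | s , s∈ , refl with combinations⁻ r xs s∈
    ... | τ , refl = standardise-isPerm (unique-⊆ τ xs-unique) , s , τ , standardise-order s

    complete : ∀ {π} → IsPerm r π × π ≼ xs → π ∈ map standardise (combinations r xs)
    complete {π} (π-perm , s , τ , o) =
      subst (_∈ map standardise (combinations r xs)) (trans (standardise-cong o) (standardise-perm π-perm))
        (∈-map⁺ standardise (subst (λ z → s ∈ combinations z xs) (trans (proj₁ o) (perm-length π-perm)) (combinations⁺ τ)))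

-- Distances between multiples of `t` modulo `M`.

-- What |σ(i) − σ(j)| + |i − j| ≥ K amounts to for σ(i) = i t mod M: here d = j − i and v, w are the values at i, j.
Spread : (K t M : ℕ) → Set
Spread K t M = ∀ d v w c → 0 < d → d * t + v ≡ w + M * c → K ≤ d + ∣ v - w ∣

-- Cancelling the smaller of `v` and `w` leaves only their difference `δ`, on one side of the
-- equation or the other.
spread : ∀ {K t M} → (∀ d δ c → 0 < d → d * t ≡ δ + M * c → K ≤ d + δ) →
         (∀ d δ c → 0 < d → d * t + δ ≡ M * c → K ≤ d + δ) → Spread K t M
spread {K} {t} {M} up down d v w c 0<d eq with ≤-total v w
... | inj₁ v≤w = subst (λ z → K ≤ d + z) (sym (m≤n⇒∣m-n∣≡n∸m v≤w))
  (up d (w ∸ v) c 0<d (+-cancelʳ-≡ v _ _ (begin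
    d * t + v                ≡⟨ eq ⟩
    w + M * c                ≡⟨ cong (_+ M * c) (sym (m∸n+n≡m v≤w)) ⟩
    w ∸ v + v + M * c        ≡⟨ rearrange (w ∸ v) v (M * c) ⟩
    w ∸ v + M * c + v        ∎)))
  where
  open ≡-Reasoning
  rearrange : ∀ l m o → l + m + o ≡ l + o + m
  rearrange = solve-∀
... | inj₂ w≤v = subst (λ z → K ≤ d + z) (sym (m≤n⇒∣n-m∣≡n∸m w≤v))
  (down d (v ∸ w) c 0<d (+-cancelʳ-≡ w _ _ (begin
    d * t + (v ∸ w) + w      ≡⟨ +-assoc (d * t) (v ∸ w) w ⟩
    d * t + (v ∸ w + w)      ≡⟨ cong (d * t +_) (m∸n+n≡m w≤v) ⟩
    d * t + v                ≡⟨ eq ⟩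
    w + M * c                ≡⟨ +-comm w (M * c) ⟩
    M * c + w                ∎)))
  where open ≡-Reasoning

-- The case of odd `k`.

module Odd (l : ℕ) where

  -- In this form `M` sits visibly between neighbouring multiples of `K`: it is `l * K` plus
  -- `l + 1`, and `suc l * K` minus `l`.
  K M : ℕ
  K = suc (2 * l)
  M = l * K + suc l

  inverse : K * K + 1 ≡ 2 * M
  inverse = identity l
    where
    identity : ∀ l → suc (2 * l) * suc (2 * l) + 1 ≡ 2 * (l * suc (2 * l) + suc l)
    identity = solve-∀

  -- After two or more turns around the modulus, `K * K` is less than `2 * M`, which is at most
  -- `(d + δ) * K`.
  big : ∀ d δ c → M * suc (suc c) ≤ d * K + δ → K ≤ d + δ
  big d δ c le = <⇒≤ (*-cancelʳ-< K K (d + δ) (begin-strict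
    K * K              <⟨ m<m+n (K * K) (s≤s z≤n) ⟩
    K * K + 1          ≡⟨ inverse ⟩
    2 * M              ≡⟨ *-comm 2 M ⟩
    M * 2              ≤⟨ *-monoʳ-≤ M (s≤s (s≤s z≤n)) ⟩
    M * suc (suc c)    ≤⟨ le ⟩
    d * K + δ          ≤⟨ +-monoʳ-≤ (d * K) (m≤m*n δ K) ⟩
    d * K + δ * K      ≡⟨ sym (*-distribʳ-+ K d δ) ⟩
    (d + δ) * K        ∎))
    where open ≤-Reasoning

  -- With no turn, `δ` is a positive multiple of `K`. With one turn, `d` is `suc l + e`, and
  -- cancelling `l * K` shows that `suc l + δ` is at least `K`.
  up : ∀ d δ c → 0 < d → d * K ≡ δ + M * c → K ≤ d + δ
  up (suc d) δ zero 0<d eq = begin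
    K               ≤⟨ m≤m+n K (d * K) ⟩
    K + d * K       ≡⟨ eq ⟩
    δ + M * 0       ≡⟨ cong (δ +_) (*-zeroʳ M) ⟩
    δ + 0           ≡⟨ +-identityʳ δ ⟩
    δ               ≤⟨ m≤n+m δ (suc d) ⟩
    suc d + δ       ∎
    where open ≤-Reasoning
  up d δ (suc zero) 0<d eq with d ≤? l
  ... | yes d≤l = ⊥-elim (<⇒≱ (m<m+n (l * K) {suc l} (s≤s z≤n)) (begin
    l * K + suc l   ≡⟨ sym (*-identityʳ M) ⟩
    M * 1           ≤⟨ m≤n+m (M * 1) δ ⟩
    δ + M * 1       ≡⟨ sym eq ⟩
    d * K           ≤⟨ *-monoˡ-≤ K d≤l ⟩
    l * K           ∎))
    where open ≤-Reasoning
  ... | no d≰l with m≤n⇒∃[o]m+o≡n (≰⇒> d≰l)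
  ... | e , refl = begin
    K                      ≤⟨ m≤m+n K (e * K) ⟩
    K + e * K              ≡⟨ +-cancelˡ-≡ (l * K) _ _ (trans (e₁ l e K) (trans eq (e₂ l δ K))) ⟩
    suc l + δ              ≤⟨ +-monoˡ-≤ δ (m≤m+n (suc l) e) ⟩
    suc l + e + δ          ∎
    where
    open ≤-Reasoning
    e₁ : ∀ l e K → l * K + (K + e * K) ≡ (suc l + e) * K
    e₁ = solve-∀
    e₂ : ∀ l δ K → δ + (l * K + suc l) * 1 ≡ l * K + (suc l + δ)
    e₂ = solve-∀
  up d δ (suc (suc c)) 0<d eq = big d δ c
    (≤-trans (≤-trans (m≤n+m (M * suc (suc c)) δ) (≤-reflexive (sym eq))) (m≤m+n (d * K) δ))

  down : 1 ≤ l → ∀ d δ c → 0 < d → d * K + δ ≡ M * c → K ≤ d + δ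
  down 1≤l (suc d) δ zero 0<d eq = contradiction (trans eq (*-zeroʳ M)) λ ()
  down 1≤l d δ (suc zero) 0<d eq with d ≤? l
  ... | yes d≤l with m≤n⇒∃[o]m+o≡n d≤l
  ... | e , d+e≡l = begin
    K                       ≡⟨ e₁ l ⟩
    l + suc l               ≡⟨ cong (_+ suc l) (sym d+e≡l) ⟩
    d + e + suc l           ≤⟨ +-monoˡ-≤ (suc l) (+-monoʳ-≤ d (m≤m*n e K)) ⟩
    d + e * K + suc l       ≡⟨ +-assoc d (e * K) (suc l) ⟩
    d + (e * K + suc l)     ≡⟨ cong (d +_) (sym δ≡) ⟩
    d + δ                   ∎
    where
    open ≤-Reasoning
    e₁ : ∀ l → suc (2 * l) ≡ l + suc l
    e₁ = solve-∀
    e₂ : ∀ d e s K → ((d + e) * K + s) * 1 ≡ d * K + (e * K + s)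
    e₂ = solve-∀
    δ≡ : δ ≡ e * K + suc l
    δ≡ = +-cancelˡ-≡ (d * K) _ _ (trans eq
           (trans (cong (λ z → (z * K + suc l) * 1) (sym d+e≡l)) (e₂ d e (suc l) K)))
  -- Already `suc l * K` exceeds `M` by `l`, which is positive.
  down 1≤l d δ (suc zero) 0<d eq | no d≰l = ⊥-elim (<⇒≱ (m<m+n _ 1≤l) (begin
    l * K + suc l + l       ≡⟨ e₁ l ⟩
    suc l * K               ≤⟨ *-monoˡ-≤ K (≰⇒> d≰l) ⟩
    d * K                   ≤⟨ m≤m+n (d * K) δ ⟩
    d * K + δ               ≡⟨ trans eq (*-identityʳ M) ⟩
    l * K + suc l           ∎))
    where
    open ≤-Reasoning
    e₁ : ∀ l → l * suc (2 * l) + suc l + l ≡ suc l * suc (2 * l)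
    e₁ = solve-∀
  down 1≤l d δ (suc (suc c)) 0<d eq = big d δ c (≤-reflexive (sym eq))

  spread-odd : 1 ≤ l → Spread K K M
  spread-odd 1≤l = spread {M = M} up (down 1≤l)

-- The case of even `k`.

module Even (j : ℕ) where

  l t K M : ℕ
  l = suc j
  t = suc (2 * j)
  K = suc t
  M = K * l

  inverse : t * suc K + 1 ≡ 2 * M
  inverse = identity j
    where
    identity : ∀ j → suc (2 * j) * suc (suc (suc (2 * j))) + 1 ≡ 2 * (suc (suc (2 * j)) * suc j)
    identity = solve-∀

  K≡2l : K ≡ l + l
  K≡2l = identity j
    where
    identity : ∀ j → suc (suc (2 * j)) ≡ suc j + suc j
    identity = solve-∀

  K∣Mc : ∀ c → K ∣ M * c
  K∣Mc c = subst (K ∣_) (sym (*-assoc K l c)) (m∣m*n (l * c))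

  -- Adding `d` replaces `t` by `K`. As `K` divides `M`, it then divides the positive number
  -- `d + δ`.
  up : ∀ d δ c → 0 < d → d * t ≡ δ + M * c → K ≤ d + δ
  up (suc d) δ c 0<d eq = ∣⇒≤ (∣m+n∣m⇒∣n {m = M * c} {suc d + δ} (subst (K ∣_) eq′ (n∣m*n (suc d))) (K∣Mc c))
    where
    eq′ : suc d * K ≡ M * c + (suc d + δ)
    eq′ = trans (*-suc (suc d) t) (trans (cong (suc d +_) eq)
            (trans (sym (+-assoc (suc d) δ (M * c))) (+-comm (suc d + δ) (M * c))))

  -- The case `d = δ` of `down`, in which divisibility says nothing. Here `d` is a positive multiple
  -- of `l`, and `K` is `2 l`.
  diagonal : ∀ d c → 0 < d → d * K ≡ M * c → K ≤ d + d
  diagonal d zero 0<d eq = contradiction (m*n≡0⇒m≡0 d K (trans eq (*-zeroʳ M))) (>⇒≢ 0<d)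
  diagonal d (suc c) 0<d eq = subst (_≤ d + d) (sym K≡2l) (+-mono-≤ l≤d l≤d)
    where
    l≤d : l ≤ d
    l≤d = subst (l ≤_) (sym (*-cancelʳ-≡ d (l * suc c) K
            (trans eq (trans (*-assoc K l (suc c)) (*-comm K (l * suc c)))))) (m≤m*n l (suc c))

  -- Now `K` divides the difference of `d` and `δ`, which is at most their sum. The split by order
  -- avoids negative numbers.
  down : ∀ d δ c → 0 < d → d * t + δ ≡ M * c → K ≤ d + δ
  down d δ c 0<d eq with ≤-total d δ
  ... | inj₁ d≤δ with m≤n⇒∃[o]m+o≡n d≤δ
  ... | zero , refl = subst (λ z → K ≤ d + z) (sym (+-identityʳ d)) (diagonal d c 0<d (trans (e d t) eq))
    where
    e : ∀ d t → d * suc t ≡ d * t + (d + 0)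
    e = solve-∀
  ... | suc ε , refl = ≤-trans (∣⇒≤ (∣m+n∣m⇒∣n (subst (K ∣_) (sym (trans (e d t (suc ε)) eq)) (K∣Mc c)) (n∣m*n d)))
                        (≤-trans (m≤n+m (suc ε) d) (m≤n+m (d + suc ε) d))
    where
    e : ∀ d t ε → d * suc t + ε ≡ d * t + (d + ε)
    e = solve-∀
  down d δ c 0<d eq | inj₂ δ≤d with m≤n⇒∃[o]m+o≡n δ≤d
  ... | zero , refl = subst (λ z → K ≤ δ + 0 + z) (+-identityʳ δ) (diagonal (δ + 0) c 0<d (trans (e δ t) eq))
    where
    e : ∀ δ t → (δ + 0) * suc t ≡ (δ + 0) * t + δ
    e = solve-∀
  ... | suc ε , refl = ≤-trans (∣⇒≤ (∣m+n∣m⇒∣n (subst (K ∣_) (trans (e δ t (suc ε)) (cong (_+ suc ε) eq)) (n∣m*n (δ + suc ε))) (K∣Mc c)))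
                        (≤-trans (m≤n+m (suc ε) δ) (m≤m+n (δ + suc ε) δ))
    where
    e : ∀ δ t ε → (δ + ε) * suc t ≡ (δ + ε) * t + δ + ε
    e = solve-∀

  spread-even : Spread K t M
  spread-even = spread {M = M} up down

-- Residues of multiples as a permutation.

lookup-applyUpTo-≡ : ∀ {A : Set} {f : ℕ → A} {n xs} → xs ≡ applyUpTo f n → ∀ i → lookup xs i ≡ f (toℕ i)
lookup-applyUpTo-≡ {f = f} {n} refl = lookup-applyUpTo f n

module Residues (t s m′ : ℕ) (inverse : t * s + 1 ≡ 2 * suc m′) where

  M : ℕ
  M = suc m′

  residue : ℕ → ℕ
  residue i = (i * t) % M

  residues : List ℕ
  residues = map residue (range1 m′)

  -- Modulo `M` the product `t * s` is -1, so multiplying by `s` recovers `d` up to sign.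
  M∣*t⇒M∣ : ∀ d → M ∣ d * t → M ∣ d
  M∣*t⇒M∣ d M∣dt = ∣m+n∣m⇒∣n (subst (M ∣_) eq (n∣m*n (d * 2))) (∣m⇒∣m*n s M∣dt)
    where
    open ≡-Reasoning
    eq : d * 2 * M ≡ d * t * s + d
    eq = begin
      d * 2 * M         ≡⟨ *-assoc d 2 M ⟩
      d * (2 * M)       ≡⟨ cong (d *_) (sym inverse) ⟩
      d * (t * s + 1)   ≡⟨ e d t s ⟩
      d * t * s + d     ∎
      where
      e : ∀ d t s → d * (t * s + 1) ≡ d * t * s + d
      e = solve-∀

  difference : ∀ {x y} → x < y → ∃ λ c → (y ∸ x) * t + residue x ≡ residue y + M * c
  difference {x} {y} x<y = c , +-cancelʳ-≡ (q * M) _ _ (begin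
    (y ∸ x) * t + residue x + q * M      ≡⟨ +-assoc ((y ∸ x) * t) (residue x) (q * M) ⟩
    (y ∸ x) * t + (residue x + q * M)    ≡⟨ cong ((y ∸ x) * t +_) (sym (m≡m%n+[m/n]*n (x * t) M)) ⟩
    (y ∸ x) * t + x * t                  ≡⟨ sym (*-distribʳ-+ t (y ∸ x) x) ⟩
    (y ∸ x + x) * t                      ≡⟨ cong (_* t) (m∸n+n≡m (<⇒≤ x<y)) ⟩
    y * t                                ≡⟨ m≡m%n+[m/n]*n (y * t) M ⟩
    residue y + q′ * M                   ≡⟨ cong (λ z → residue y + z * M) (sym (m∸n+n≡m q≤q′)) ⟩
    residue y + (c + q) * M              ≡⟨ e (residue y) c q M ⟩
    residue y + M * c + q * M            ∎)
    where
    open ≡-Reasoning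
    q q′ c : ℕ
    q = x * t / M
    q′ = y * t / M
    c = q′ ∸ q
    q≤q′ : q ≤ q′
    q≤q′ = /-monoˡ-≤ M (*-monoˡ-≤ t (<⇒≤ x<y))
    e : ∀ r c q M → r + (c + q) * M ≡ r + M * c + q * M
    e = solve-∀

  residue-≢ : ∀ {x y} → x < y → y ≤ m′ → residue x ≢ residue y
  residue-≢ {x} {y} x<y y≤m′ e with difference x<y
  ... | c , eq = <⇒≱ (s≤s (≤-trans (m∸n≤m y x) y≤m′)) (∣⇒≤ ⦃ >-nonZero (m<n⇒0<n∸m x<y) ⦄ (M∣*t⇒M∣ (y ∸ x) M∣))
    where
    M∣ : M ∣ (y ∸ x) * t
    M∣ = subst (M ∣_) (sym (+-cancelʳ-≡ (residue x) _ _ (trans eq (trans (+-comm (residue y) (M * c)) (cong (M * c +_) (sym e)))))) (m∣m*n c)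

  residue-positive : ∀ {x} → 0 < x → x ≤ m′ → 0 < residue x
  -- `residue 0` computes to 0, so being nonzero is a case of distinctness.
  residue-positive 0<x x≤m′ = ≤∧≢⇒< z≤n (residue-≢ 0<x x≤m′)

  residues-perm : IsPerm m′ residues
  residues-perm = unique⇒↭ (unique-map inj (range1-unique m′)) sub (≤-reflexive (sym (length-map residue (range1 m′))))
    where
    inj : ∀ {x y} → x ∈ range1 m′ → y ∈ range1 m′ → residue x ≡ residue y → x ≡ y
    inj {x} {y} x∈ y∈ e with ∈-range1⁻ x∈ | ∈-range1⁻ y∈ | <-cmp x y
    ... | _ | _ | tri≈ _ x≡y _ = x≡y
    ... | _ | _ , y≤m′ , refl | tri< lt _ _ = contradiction e (residue-≢ lt y≤m′)
    ... | _ , x≤m′ , refl | _ | tri> _ _ gt = contradiction (sym e) (residue-≢ gt x≤m′)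
    sub : ∀ {v} → v ∈ residues → v ∈ range1 m′
    sub v∈ with ∈-map⁻ residue v∈
    ... | x , x∈ , refl with ∈-range1⁻ x∈
    ... | u , x≤m′ , refl with residue (suc u) | residue-positive (s≤s z≤n) x≤m′ | m%n<n (suc u * t) M
    ... | suc w | _ | s≤s w<m′ = ∈-range1⁺ w<m′

  residues-far : ∀ {K} → Spread K t M → ∀ {i j} → toℕ i < toℕ j →
                 K ≤ ∣ toℕ i - toℕ j ∣ + ∣ lookup residues i - lookup residues j ∣
  -- List position `i` carries the residue of `suc i`; the shift leaves differences of positions
  -- unchanged.
  residues-far {K} sp {i} {j} i<j with difference (s≤s i<j)
  ... | c , eq = subst₂ (λ d δ → K ≤ d + δ)
    (sym (m≤n⇒∣m-n∣≡n∸m (<⇒≤ i<j))) (sym (cong₂ ∣_-_∣ (value i) (value j)))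
    (sp (toℕ j ∸ toℕ i) (residue (suc (toℕ i))) (residue (suc (toℕ j))) c (m<n⇒0<n∸m i<j) eq)
    where
    value : ∀ i → lookup residues i ≡ residue (suc (toℕ i))
    value = lookup-applyUpTo-≡ {f = residue ∘ suc} {n = m′}
              (trans (sym (map-∘ (upTo m′))) (map-upTo (residue ∘ suc) m′))

  residues-breadth : ∀ {K} → Spread K t M → Breadth≥ K residues
  residues-breadth {K} sp {i} {j} i≢j with <-cmp (toℕ i) (toℕ j)
  ... | tri< lt _ _ = residues-far sp lt
  ... | tri≈ _ e _  = contradiction (toℕ-injective e) i≢j
  ... | tri> _ _ gt = subst₂ (λ d δ → K ≤ d + δ) (∣-∣-comm (toℕ j) (toℕ i))
                        (∣-∣-comm (lookup residues j) (lookup residues i)) (residues-far sp gt)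

-- Matching multiplier and modulus with `k`.

-- The factor 2 stands on the right so that `suc j * 2` computes to `suc (suc (j * 2))`.
data Parity : ℕ → Set where
  even : ∀ j → Parity (j * 2)
  odd  : ∀ j → Parity (1 + j * 2)

parity-of : ∀ k → Parity k
parity-of zero          = even 0
parity-of (suc zero)    = odd 0
parity-of (suc (suc k)) with parity-of k
... | even j = even (suc j)
... | odd j  = odd (suc j)

mult-odd : ∀ j → mult (1 + j * 2) ≡ Odd.K (suc j)
mult-odd j = trans (cong (λ z → if z ≡ᵇ 1 then 1 + j * 2 + 2 else 1 + j * 2 + 1) ([m+kn]%n≡m%n 1 j 2)) (identity j)
  where
  identity : ∀ j → 1 + j * 2 + 2 ≡ suc (2 * suc j)
  identity = solve-∀

mult-even : ∀ j → mult (j * 2) ≡ Even.t j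
mult-even j = trans (cong (λ z → if z ≡ᵇ 1 then j * 2 + 2 else j * 2 + 1) ([m+kn]%n≡m%n 0 j 2)) (identity j)
  where
  identity : ∀ j → j * 2 + 1 ≡ suc (2 * j)
  identity = solve-∀

modulus-odd : ∀ j → suc (m (1 + j * 2)) ≡ Odd.M (suc j)
modulus-odd j = trans (cong (λ z → suc (z + 2 * (1 + j * 2) + 1)) half) (identity j)
  where
  square : ∀ j → (1 + j * 2) * (1 + j * 2) + 1 ≡ (2 * j * j + 2 * j + 1) * 2
  square = solve-∀
  half : ((1 + j * 2) * (1 + j * 2) + 1) / 2 ≡ 2 * j * j + 2 * j + 1
  half = trans (cong (_/ 2) (square j)) (m*n/n≡m (2 * j * j + 2 * j + 1) 2)
  identity : ∀ j → suc (2 * j * j + 2 * j + 1 + 2 * (1 + j * 2) + 1) ≡ suc j * suc (2 * suc j) + suc (suc j)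
  identity = solve-∀

modulus-even : ∀ j → suc (m (j * 2)) ≡ Even.M j
modulus-even j = trans (cong (λ z → suc (z + 2 * (j * 2) + 1)) half) (identity j)
  where
  square : ∀ j → j * 2 * (j * 2) + 1 ≡ 1 + 2 * j * j * 2
  square = solve-∀
  half : (j * 2 * (j * 2) + 1) / 2 ≡ 2 * j * j
  -- The square is even here, so the added 1 is lost in the quotient.
  half = trans (cong (_/ 2) (square j)) (trans (+-distrib-/-∣ʳ 1 {d = 2} (n∣m*n (2 * j * j))) (m*n/n≡m (2 * j * j) 2))
  identity : ∀ j → suc (2 * j * j + 2 * (j * 2) + 1) ≡ suc (suc (2 * j)) * suc j
  identity = solve-∀

-- The first component says that t is a unit modulo M.
Admissible : (K t M : ℕ) → Set
Admissible K t M = (∃ λ s → t * s + 1 ≡ 2 * M) × Spread K t M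

admissible-resp : ∀ {K K′ t t′ M M′} → K ≡ K′ → t ≡ t′ → M ≡ M′ → Admissible K′ t′ M′ → Admissible K t M
admissible-resp refl refl refl A = A

admissible : ∀ k → Admissible (k + 2) (mult k) (suc (m k))
admissible k with parity-of k
... | odd j = admissible-resp (identity j) (mult-odd j) (modulus-odd j)
  ((Odd.K (suc j) , Odd.inverse (suc j)) , Odd.spread-odd (suc j) (s≤s z≤n))
  where
  identity : ∀ j → 1 + j * 2 + 2 ≡ suc (2 * suc j)
  identity = solve-∀
... | even j = admissible-resp (identity j) (mult-even j) (modulus-even j)
  ((suc (Even.K j) , Even.inverse j) , Even.spread-even j)
  where
  identity : ∀ j → j * 2 + 2 ≡ suc (suc (2 * j))
  identity = solve-∀

theorem4p2 : (k : ℕ) → 1 ≤ k → IsPerm (m k) (σ k) × KProlific k (σ k)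
theorem4p2 k 1≤k with admissible k
... | (s , inverse) , sp =
  σ-perm , 1≤k , subst (k <_) (sym length-σ) k<m , m k ∸ k ,
  trans (m∸n+n≡m (<⇒≤ k<m)) (sym length-σ) ,
  subst (λ z → PatternCount (m k ∸ k) (σ k) (z C k)) (sym length-σ)
    (patternCount σ-perm (residues-breadth sp) (m∸n+n≡m (<⇒≤ k<m)))
  where
  open Residues (mult k) s (m k) inverse
  σ-perm : IsPerm (m k) (σ k)
  σ-perm = residues-perm
  length-σ : length (σ k) ≡ m k
  length-σ = perm-length σ-perm
  k<m : k < m k
  k<m = begin-strict
    k                               ≤⟨ m≤n*m k 2 ⟩
    2 * k                           ≤⟨ m≤n+m (2 * k) ((k * k + 1) / 2) ⟩
    (k * k + 1) / 2 + 2 * k         <⟨ m<m+n _ (s≤s z≤n) ⟩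
    m k                             ∎
    where open ≤-Reasoning
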